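{- Let $\mathcal{P}$ be a symmetric sign pattern of order $n+m$ with all diagonal entries equal to $0$, whose underlying signed undirected graph is $G(\mathcal{P})=C_n\cdot mP_1$, where $1<m\le n$. Then $\mathcal{P}$ requires full $P$-vertices if and only if the distance between any two consecutive hosts is odd.
   Context: A sign pattern of order $N$ is an $N\times N$ matrix $\mathcal{P}=[p_{ij}]$ with entries in $\{+,-,0\}$; it is symmetric if $p_{ij}=p_{ji}$ for all $i,j$. $\mathcal{Q}_{\mathrm{SYM}}(\mathcal{P})$ is the set of all real symmetric $N\times N$ matrices $A=[a_{ij}]$ with $\mathrm{sgn}(a_{ij})=p_{ij}$ for all $i,j$. The underlying signed undirected graph $G(\mathcal{P})$ has vertices $v_1,\dots,v_N$ and an edge $\{v_i,v_j\}$ exactly when $p_{ij}\neq 0$. $C_n$ is the cycle of length $n$ ($n\ge 3$), and $P_1$ is the path of length $1$ (one edge). The graph $C_n\cdot mP_1$ is obtained by attaching a copy of $P_1$ to each of $m$ distinct vertices of $C_n$, that is, by attaching one pendant vertex to each of these $m$ vertices; the $m$ selected vertices are called hosts. Two hosts are consecutive if they are consecutive among the hosts in the cyclic order around $C_n$. The distance $\mathrm{dist}(u,v)$ between two vertices $u,v$ is the minimum length (number of edges) among all paths from $u$ to $v$ in $G(\mathcal{P})$. For a real symmetric matrix $A$, $m_A(0)$ is the algebraic multiplicity of $0$ as an eigenvalue of $A$ (zero if $0$ is not an eigenvalue), and $A(j)$ is the principal submatrix of $A$ obtained by deleting row and column $j$. The vertex $v_j$ is a $P$-vertex of $A$ if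 $m_{A(j)}(0)-m_A(0)=1$. A symmetric sign pattern $\mathcal{P}$ of order $N$ requires full $P$-vertices if, for every $A\in\mathcal{Q}_{\mathrm{SYM}}(\mathcal{P})$, all $N$ vertices are $P$-vertices of $A$.
   Formalization: The distance between consecutive hosts is taken as the length of the arc of C_n joining them that has no other host (both arcs if m=2), not the shortest path: with that the claim fails, e.g. n=3, m=2, where the hosts are at distance 1 but deleting the nonhost leaves a nonsingular path matrix. -}

module Defs where

open import Level using (_⊔_; 0ℓ) renaming (suc to lsuc)
open import Algebra.Bundles using (CommutativeRing; RawRing)
open import Algebra.Structures using (IsCommutativeRing)
import Algebra.Definitions.RawMonoid as RawMonoidDefs
import Algebra.Definitions.RawSemiring as RawSemiringDefs
open import Data.Bool.Base using (if_then_else_)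
open import Data.Empty using (⊥)
open import Data.Fin.Base using (Fin; zero; suc; toℕ)
open import Data.Fin.Properties using (_≟_)
open import Data.List.Base using (List; []; _∷_; map; foldr)
open import Data.Nat.Base using (ℕ; zero; suc; pred; _<_; _%_)
import Data.Nat.Base as ℕ
open import Data.Nat.DivMod using (_mod_)
open import Data.Product.Base using (_×_; Σ-syntax; ∃-syntax)
open import Data.Sum.Base using (_⊎_; inj₁; inj₂)
open import Data.Vec.Functional using (removeAt)
open import Function.Bundles using (_⇔_; _↔_; _↣_; Inverse; Injection)
open import Relation.Binary.Core using (Rel)
open import Relation.Binary.Definitions using (tri<; tri≈; tri>)
open import Relation.Binary.PropositionalEquality using (_≡_; _≢_)
open import Relation.Binary.Structures using (IsStrictTotalOrder)
open import Relation.Nullary using (¬_; does)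
open import Relation.Unary using (Pred)

-- The real numbers, axiomatised as a Dedekind-complete (totally) ordered
-- field.  Classically such a field is unique up to isomorphism.

record RealField c ℓ₁ ℓ₂ : Set (lsuc (c ⊔ ℓ₁ ⊔ ℓ₂)) where
  infix  8 -_
  infixl 7 _*_
  infixl 6 _+_
  infix  4 _≈_ _<ʳ_ _≤ʳ_
  field
    Carrier : Set c
    _≈_     : Rel Carrier ℓ₁
    _<ʳ_    : Rel Carrier ℓ₂
    _+_     : Carrier → Carrier → Carrier
    _*_     : Carrier → Carrier → Carrier
    -_      : Carrier → Carrier
    0#      : Carrier
    1#      : Carrier

    isCommutativeRing  : IsCommutativeRing _≈_ _+_ _*_ -_ 0# 1#
    0≉1                : ¬ (0# ≈ 1#)
    inverse            : ∀ x → ¬ (x ≈ 0#) → ∃[ y ] x * y ≈ 1#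

    isStrictTotalOrder : IsStrictTotalOrder _≈_ _<ʳ_
    +-monoˡ-<          : ∀ z {x y} → x <ʳ y → x + z <ʳ y + z
    *-pos              : ∀ {x y} → 0# <ʳ x → 0# <ʳ y → 0# <ʳ x * y

  _≤ʳ_ : Rel Carrier ℓ₂
  x ≤ʳ y = ¬ (y <ʳ x)

  UpperBound : Pred Carrier (c ⊔ ℓ₁ ⊔ ℓ₂) → Carrier → Set (c ⊔ ℓ₁ ⊔ ℓ₂)
  UpperBound S b = ∀ x → S x → x ≤ʳ b

  field
    complete : (S : Pred Carrier (c ⊔ ℓ₁ ⊔ ℓ₂)) →
               ∃[ x ] S x → ∃[ b ] UpperBound S b →
               ∃[ s ] (UpperBound S s × (∀ b → UpperBound S b → s ≤ʳ b))

  commutativeRing : CommutativeRing c ℓ₁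
  commutativeRing = record { isCommutativeRing = isCommutativeRing }

  rawRing : RawRing c ℓ₁
  rawRing = CommutativeRing.rawRing commutativeRing

  open IsStrictTotalOrder isStrictTotalOrder public using (compare)

Matrix : ∀ {a} → Set a → ℕ → Set a
Matrix A N = Fin N → Fin N → A

-- The principal submatrix A(j).
delete : ∀ {a} {A : Set a} {N} → Matrix A N → Fin N → Matrix A (pred N)
delete {N = suc N} A j = removeAt (λ i → removeAt (A i) j) j

module _ {c ℓ} (R : RawRing c ℓ) where
  open RawRing R
  open RawMonoidDefs +-rawMonoid using (sum)
  open RawSemiringDefs rawSemiring using (_^_)

  -- Laplace expansion along the first row.
  det : ∀ {N} → Matrix Carrier N → Carrier
  det {zero}  A = 1#
  det {suc N} A = sum λ j →
    (- 1#) ^ toℕ j * (A zero j * det (λ i → removeAt (A (suc i)) j))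

-- Univariate polynomials as coefficient lists, constant term first; trailing
-- zeros are allowed, so equality is equality of all coefficients.
module Polynomial {c ℓ} (R : RawRing c ℓ) where
  open RawRing R

  Poly : Set c
  Poly = List Carrier

  coeff : Poly → ℕ → Carrier
  coeff []      _       = 0#
  coeff (a ∷ p) zero    = a
  coeff (a ∷ p) (suc k) = coeff p k

  infix  4 _≈ₚ_
  infixl 6 _+ₚ_
  infixl 7 _*ₚ_

  _≈ₚ_ : Rel Poly ℓ
  p ≈ₚ q = ∀ k → coeff p k ≈ coeff q k

  _+ₚ_ : Poly → Poly → Poly
  []      +ₚ q       = q
  (a ∷ p) +ₚ []      = a ∷ p
  (a ∷ p) +ₚ (b ∷ q) = a + b ∷ p +ₚ q

  _*ₚ_ : Poly → Poly → Poly
  []      *ₚ q = []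
  (a ∷ p) *ₚ q = map (a *_) q +ₚ (0# ∷ p *ₚ q)

  eval : Poly → Carrier → Carrier
  eval p x = foldr (λ a r → a + x * r) 0# p

  polyRing : RawRing c ℓ
  polyRing = record
    { Carrier = Poly ; _≈_ = _≈ₚ_ ; _+_ = _+ₚ_ ; _*_ = _*ₚ_
    ; -_ = map -_ ; 0# = [] ; 1# = 1# ∷ [] }

  open RawSemiringDefs (RawRing.rawSemiring polyRing) public using ()
    renaming (_^_ to _^ₚ_)

  X-_ : Carrier → Poly
  X- a = - a ∷ 1# ∷ []

  charPoly : ∀ {N} → Matrix Carrier N → Poly
  charPoly A = det polyRing λ i j →
    if does (i ≟ j) then X- (A i j) else - A i j ∷ []

  -- AlgMult A x k : the algebraic multiplicity m_A(x) equals k, i.e. X - x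
  -- divides the characteristic polynomial exactly k times (k = 0 exactly when
  -- x is not an eigenvalue).
  AlgMult : ∀ {N} → Matrix Carrier N → Carrier → ℕ → Set (c ⊔ ℓ)
  AlgMult A x k =
    ∃[ q ] (charPoly A ≈ₚ (X- x) ^ₚ k *ₚ q × ¬ (eval q x ≈ 0#))

data Sgn : Set where
  pos neg nul : Sgn

SignPattern : ℕ → Set
SignPattern = Matrix Sgn

SymmetricPattern : ∀ {N} → SignPattern N → Set
SymmetricPattern P = ∀ i j → P i j ≡ P j i

ZeroDiagonal : ∀ {N} → SignPattern N → Set
ZeroDiagonal P = ∀ i → P i i ≡ nul

module _ {c ℓ₁ ℓ₂} (ℝ : RealField c ℓ₁ ℓ₂) where
  open RealField ℝ
  open Polynomial rawRing using (AlgMult)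

  sgn : Carrier → Sgn
  sgn x with compare 0# x
  ... | tri< _ _ _ = pos
  ... | tri≈ _ _ _ = nul
  ... | tri> _ _ _ = neg

  Q-SYM : ∀ {N} → SignPattern N → Pred (Matrix Carrier N) ℓ₁
  Q-SYM P A = (∀ i j → A i j ≈ A j i) × (∀ i j → sgn (A i j) ≡ P i j)

  PVertex : ∀ {N} → Matrix Carrier N → Fin N → Set (c ⊔ ℓ₁)
  PVertex A j = ∃[ k ] (AlgMult A 0# k × AlgMult (delete A j) 0# (suc k))

  RequiresFullPVertices : ∀ {N} → SignPattern N → Set (c ⊔ ℓ₁)
  RequiresFullPVertices P = ∀ A → Q-SYM P A → ∀ j → PVertex A j

-- An undirected graph is given by its adjacency relation.
Graph : Set → Set₁
Graph V = Rel V 0ℓ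

infix 4 _≅_
_≅_ : ∀ {V W} → Graph V → Graph W → Set
_≅_ {V} {W} G H =
  Σ[ φ ∈ V ↔ W ] (∀ u v → G u v ⇔ H (Inverse.to φ u) (Inverse.to φ v))

G[_] : ∀ {N} → SignPattern N → Graph (Fin N)
G[ P ] i j = P i j ≢ nul

-- The vertex reached from u by d steps around the cycle.
infixl 6 _⊕_
_⊕_ : ∀ {n} → Fin n → ℕ → Fin n
_⊕_ {suc n} u d = (toℕ u ℕ.+ d) mod suc n

C : ∀ n → Graph (Fin n)
C n u v = v ≡ u ⊕ 1 ⊎ u ≡ v ⊕ 1

-- C n ·P₁ host is C_n with one pendant vertex inj₂ k attached to host k, for
-- each k : Fin m; the injection makes the m hosts distinct.
C_·P₁_ : ∀ n {m} → Fin m ↣ Fin n → Graph (Fin n ⊎ Fin m)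
(C n ·P₁ host) (inj₁ u) (inj₁ v) = C n u v
(C n ·P₁ host) (inj₁ u) (inj₂ k) = u ≡ Injection.to host k
(C n ·P₁ host) (inj₂ k) (inj₁ u) = u ≡ Injection.to host k
(C n ·P₁ host) (inj₂ k) (inj₂ l) = ⊥

-- host j is the first host met after host i when going around the cycle, and
-- it is met after d steps: d is the distance between these consecutive hosts,
-- measured along the arc from one to the other that contains no further host.
-- This may differ from the length of a shortest path in the whole graph: for
-- instance, two hosts on C_3 are consecutive along an arc of length 1 and along
-- an arc of length 2, and both arcs count.  With shortest paths the
-- characterisation of patterns requiring full P-vertices fails for odd n.
record ConsecutiveHosts {n m} (host : Fin m ↣ Fin n) (i j : Fin m) (d : ℕ) : Set where
  open Injection host using (to)
  field
    positive : 0 < d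
    reached  : to j ≡ to i ⊕ d
    first    : ∀ e → 0 < e → e < d → ∀ k → to k ≢ to i ⊕ e

Odd : ℕ → Set
Odd d = d % 2 ≡ 1

{-# OPTIONS --safe #-}

-- An invertible symmetric B has all its vertices as P-vertices as soon as its
-- inverse has zero diagonal: then det B(j) = 0 for every j, and 0 is a simple
-- root of the characteristic polynomial of the symmetric matrix B(j).
-- Conversely, if all vertices of A are P-vertices then A is invertible, because
-- χ_A′ is the sum of the χ_{A(j)}, so that a root 0 of χ_A would have larger
-- multiplicity in χ_A′ than in χ_A.
--
-- It remains to see how a solution x of A x = c e_j behaves on the graph.  The
-- equation at a pendant vertex makes x vanish at its host, and the equations
-- along an arc carry zeros two steps further, from either end.  If every arc is
-- odd, each vertex j is reached by zeros whose equations avoid j, so x_j = 0 and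
-- the inverse has zero diagonal.  If some arc is even, take j next to one of its
-- ends: all neighbours of j get zeros, hence c = 0 and A is singular.
module Submission where

open import Defs
open import Data.Fin.Base using (Fin; zero; suc; toℕ; punchIn; punchOut)
open import Data.Nat.Base using (ℕ; zero; suc; _∸_; _/_; _%_; _≤_; _<_; s≤s; z≤n; z<s; s<s)
open import Function.Bundles using (_⇔_; _↣_; mk⇔; Injection; Inverse; Equivalence)

open import Algebra.Bundles using (CommutativeRing; RawRing)
import Algebra.Construct.Pointwise as Pointwise
import Algebra.Definitions.RawMonoid as RawMonoidDefs
import Algebra.Definitions.RawSemiring as RawSemiringDefs
open import Algebra.Morphism.Structures using (module RingMorphisms)
import Algebra.Properties.CommutativeMonoid.Mult as CommutativeMonoidMult
import Algebra.Properties.CommutativeSemigroup as CSP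
import Algebra.Properties.Ring as RingProperties
import Algebra.Properties.Semiring.Mult as SemiringMult
import Algebra.Properties.Semiring.Sum as SemiringSum
import Algebra.Solver.Ring.NaturalCoefficients.Default as NaturalSolver
open import Data.Bool.Base using (true; false; if_then_else_)
import Data.Fin.Properties as Fin
open import Data.Fin.Properties using (_≟_; any?; punchIn-injective; punchIn-punchOut; punchInᵢ≢i)
import Data.List.Base as List
open import Data.Nat.DivMod using (m%n<n; m<n⇒m%n≡m; m%n%n≡m%n; %-distribˡ-+; [m+n]%n≡m%n; m≡m%n+[m/n]*n)
open import Data.Nat.Induction using (<-rec)
import Data.Nat.Properties as ℕ
open import Data.Product.Base using (_×_; _,_; ∃-syntax; proj₁; proj₂)
open import Data.Sum.Base using (_⊎_; inj₁; inj₂)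
open import Data.Sum.Properties using (inj₁-injective; inj₂-injective)
open import Data.Vec.Functional using (Vector; insertAt; removeAt; updateAt; _∷_; tail)
open import Data.Vec.Functional.Properties using (insertAt-lookup; insertAt-punchIn; updateAt-updates; updateAt-minimal)
open import Function.Base using (_∘_)
open import Relation.Binary.Definitions using (tri<; tri≈; tri>)
open import Relation.Binary.PropositionalEquality as ≡ using (_≡_; _≢_)
open import Relation.Binary.Structures using (IsStrictTotalOrder)
open import Relation.Nullary using (¬_; Dec; yes; no; does; contradiction)
open import Relation.Nullary.Decidable using (dec-true; dec-false)
open import Relation.Unary using (Decidable)

-- The multiplicity of 0 is defined by divisibility of a Laplace determinant over coefficient lists.
-- Read as a power series, a polynomial is divisible by the k-th power of `X` exactly when its first
-- k coefficients vanish, and power series form a commutative ring. One theory of determinants over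
-- commutative rings then serves both `A` and `X I - A`, and ring homomorphisms link the two. Why 0
-- is a simple root for B(j): the kernel of B(j) is a line, spanned by column j of the inverse with
-- its vanishing entry j dropped. A double root of a symmetric matrix over an ordered field would
-- make every cofactor vanish, whereas a kernel that is a line leaves some cofactor nonzero. Columns
-- of the inverse appear as cofactor vectors, scaled by the determinant, so that they exist over the
-- series ring as well.

-- The index of column j once column punchIn j l is removed: deleting column j and
-- then l, or punchIn j l and then partner j l, removes the same two columns.
partner : ∀ {n} → Fin (suc n) → Fin n → Fin n
partner {suc n} zero    l       = zero
partner {suc n} (suc j) zero    = j
partner {suc n} (suc j) (suc l) = suc (partner j l)

punchIn-partner : ∀ {n} (j : Fin (suc n)) l → punchIn (punchIn j l) (partner j l) ≡ j
punchIn-partner {suc n} zero    l       = ≡.refl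
punchIn-partner {suc n} (suc j) zero    = ≡.refl
punchIn-partner {suc n} (suc j) (suc l) = ≡.cong suc (punchIn-partner j l)

punchIn-punchIn : ∀ {n} (j : Fin (suc (suc n))) l (i : Fin n) →
  punchIn j (punchIn l i) ≡ punchIn (punchIn j l) (punchIn (partner j l) i)
punchIn-punchIn zero    l       i       = ≡.refl
punchIn-punchIn (suc j) zero    i       = ≡.refl
punchIn-punchIn (suc j) (suc l) zero    = ≡.refl
punchIn-punchIn (suc j) (suc l) (suc i) = ≡.cong suc (punchIn-punchIn j l i)

-- Determinants over a commutative ring

module Determinant {c ℓ} (R : CommutativeRing c ℓ) where
  open CommutativeRing R hiding (zero)
  open SemiringSum semiring
  open RawSemiringDefs (RawRing.rawSemiring rawRing) using (_^_)
  open RingProperties ring using (-1*x≈-x; -‿distribʳ-*; -‿involutive)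
    renaming (+-inverseˡ-unique to inverseˡ-unique)
  open CSP *-commutativeSemigroup using (x∙yz≈y∙xz)
  open import Relation.Binary.Reasoning.Setoid setoid

  σ : ∀ {n} → Fin n → Carrier
  σ j = (- 1#) ^ toℕ j

  -- Opacity keeps sums and determinants of symbolic size from unfolding, so that
  -- unification can read off their arguments.
  opaque
    ∑ : ∀ {n} → Vector Carrier n → Carrier
    ∑ = sum

    Det : ∀ {n} → Matrix Carrier n → Carrier
    Det = det rawRing

    -- The determinant of the square matrix with top row `v` above the rows `B`, with the top row
    -- kept apart so that it can be varied freely.
    Δ : ∀ {n} → Vector Carrier (suc n) → (Fin n → Vector Carrier (suc n)) → Carrier
    Δ v B = ∑ λ j → σ j * (v j * Det λ i → removeAt (B i) j)

    Det≡det : ∀ {n} (A : Matrix Carrier n) → Det A ≡ det rawRing A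
    Det≡det A = ≡.refl

    ∑-empty : ∀ (f : Vector Carrier 0) → ∑ f ≈ 0#
    ∑-empty f = refl

    ∑-suc : ∀ {n} (f : Vector Carrier (suc n)) → ∑ f ≈ f zero + ∑ (tail f)
    ∑-suc f = refl

    ∑-remove : ∀ {n} (f : Vector Carrier (suc n)) i → ∑ f ≈ f i + ∑ (removeAt f i)
    ∑-remove f i = sum-remove {i = i} f

    ∑-cong : ∀ {n} {f g : Vector Carrier n} → (∀ i → f i ≈ g i) → ∑ f ≈ ∑ g
    ∑-cong = sum-cong-≋

    ∑-zero : ∀ {n} {f : Vector Carrier n} → (∀ i → f i ≈ 0#) → ∑ f ≈ 0#
    ∑-zero {n} f≈0 = trans (sum-cong-≋ f≈0) (sum-replicate-zero n)

    ∑-+ : ∀ {n} (f g : Vector Carrier n) → ∑ (λ i → f i + g i) ≈ ∑ f + ∑ g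
    ∑-+ = ∑-distrib-+

    ∑-swap : ∀ {m n} (f : Fin m → Fin n → Carrier) → (∑ λ i → ∑ (f i)) ≈ (∑ λ j → ∑ λ i → f i j)
    ∑-swap = ∑-comm

    *-∑ : ∀ {n} x (f : Vector Carrier n) → x * ∑ f ≈ ∑ λ i → x * f i
    *-∑ = *-distribˡ-sum

    ∑-single : ∀ {n} (f : Vector Carrier n) i → (∀ j → j ≢ i → f j ≈ 0#) → ∑ f ≈ f i
    ∑-single {suc n} f i f≈0 = begin
      sum f                      ≈⟨ sum-remove {i = i} f ⟩
      f i + sum (removeAt f i)   ≈⟨ +-congˡ (∑-zero λ j → f≈0 _ (punchInᵢ≢i i j)) ⟩
      f i + 0#                   ≈⟨ +-identityʳ _ ⟩
      f i                        ∎

    det-cong : ∀ {n} {A B : Matrix Carrier n} → (∀ i j → A i j ≈ B i j) → Det A ≈ Det B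
    det-cong {zero}  A≈B = refl
    det-cong {suc n} A≈B = ∑-cong λ j → *-congˡ {x = σ j} (*-cong (A≈B zero j)
      (det-cong λ i l → A≈B (suc i) (punchIn j l)))

    Δ-cong : ∀ {n} {u v : Vector Carrier (suc n)} {A B} →
      (∀ j → u j ≈ v j) → (∀ i j → A i j ≈ B i j) → Δ u A ≈ Δ v B
    Δ-cong u≈v A≈B = ∑-cong λ j → *-congˡ {x = σ j} (*-cong (u≈v j)
      (det-cong λ i l → A≈B i (punchIn j l)))

    Δ-expand : ∀ {n} v (B : Fin n → Vector Carrier (suc n)) →
      Δ v B ≈ ∑ λ j → σ j * (v j * Det λ i → removeAt (B i) j)
    Δ-expand v B = refl

    det-empty : (A : Matrix Carrier 0) → Det A ≈ 1#
    det-empty A = refl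

    det-Δ : ∀ {n} (A : Matrix Carrier (suc n)) → Det A ≈ Δ (A zero) (tail A)
    det-Δ A = refl

  σ-suc : ∀ {n} (j : Fin n) x → σ (suc j) * x ≈ - (σ j * x)
  σ-suc j x = begin
    (- 1# * σ j) * x ≈⟨ *-assoc _ _ _ ⟩
    - 1# * (σ j * x) ≈⟨ -1*x≈-x _ ⟩
    - (σ j * x)      ∎

  σ² : ∀ {n} (j : Fin n) x → σ j * (σ j * x) ≈ x
  σ² zero    x = trans (*-identityˡ _) (*-identityˡ _)
  σ² (suc j) x = begin
    σ (suc j) * (σ (suc j) * x) ≈⟨ σ-suc j _ ⟩
    - (σ j * (σ (suc j) * x))   ≈⟨ -‿cong (*-congˡ (σ-suc j x)) ⟩
    - (σ j * - (σ j * x))       ≈⟨ -‿cong (-‿distribʳ-* _ _) ⟨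
    - - (σ j * (σ j * x))       ≈⟨ -‿involutive _ ⟩
    σ j * (σ j * x)             ≈⟨ σ² j x ⟩
    x                           ∎

  Δ-scale : ∀ {n} a v {A B : Fin n → Vector Carrier (suc n)} →
    (∀ j → Det (λ i → removeAt (A i) j) ≈ a * Det (λ i → removeAt (B i) j)) →
    Δ v A ≈ a * Δ v B
  Δ-scale a v {A} {B} minors = begin
    Δ v A
      ≈⟨ Δ-expand v A ⟩
    (∑ λ j → σ j * (v j * Det λ i → removeAt (A i) j))
      ≈⟨ ∑-cong (λ j → trans (*-congˡ {x = σ j} (trans (*-congˡ (minors j)) (x∙yz≈y∙xz _ _ _))) (x∙yz≈y∙xz _ _ _)) ⟩
    (∑ λ j → a * (σ j * (v j * Det λ i → removeAt (B i) j)))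
      ≈⟨ *-∑ a _ ⟨
    a * (∑ λ j → σ j * (v j * Det λ i → removeAt (B i) j))
      ≈⟨ *-congˡ (Δ-expand v B) ⟨
    a * Δ v B
      ∎

  -- The shape of a Laplace expansion along two rows: the pair `j`, `l` stands for the ordered pair
  -- of distinct columns `j` and `punchIn j l`.
  altSum : ∀ {n} → (Fin (suc n) → Fin n → Carrier) → Carrier
  altSum g = ∑ λ j → ∑ λ l → σ j * (σ l * g j l)

  -- Exchanging the two columns of a pair flips the sign. Pairs involving column `zero` cancel as
  -- (`zero`, `l`) against (`suc l`, `zero`); the other pairs form an `altSum` with one column
  -- fewer, in which the two sign changes compensate.
  altSum-symmetric : ∀ {n} (g : Fin (suc n) → Fin n → Carrier) →
    (∀ j l → g j l ≈ g (punchIn j l) (partner j l)) → altSum g ≈ 0#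
  altSum-symmetric {zero}  g g-sym = ∑-zero λ j → ∑-zero λ ()
  altSum-symmetric {suc n} g g-sym = begin
    altSum g
      ≈⟨ ∑-suc _ ⟩
    ∑ first + (∑ λ j → ∑ (rest j))
      ≈⟨ +-congˡ (∑-cong λ j → ∑-suc (rest j)) ⟩
    ∑ first + (∑ λ j → rest j zero + ∑ (rest j ∘ suc))
      ≈⟨ +-congˡ (∑-+ (λ j → rest j zero) _) ⟩
    ∑ first + ((∑ λ j → rest j zero) + (∑ λ j → ∑ (rest j ∘ suc)))
      ≈⟨ +-assoc _ _ _ ⟨
    (∑ first + (∑ λ j → rest j zero)) + (∑ λ j → ∑ (rest j ∘ suc))
      ≈⟨ +-cong (trans (sym (∑-+ first _)) (∑-zero cancel)) (∑-cong λ j → ∑-cong λ l → double j l) ⟩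
    0# + altSum (λ j l → g (suc j) (suc l))
      ≈⟨ +-identityˡ _ ⟩
    altSum (λ j l → g (suc j) (suc l))
      ≈⟨ altSum-symmetric (λ j l → g (suc j) (suc l)) (λ j l → g-sym (suc j) (suc l)) ⟩
    0# ∎
    where
    first : Vector Carrier (suc n)
    first l = 1# * (σ l * g zero l)
    rest : Fin (suc n) → Vector Carrier (suc n)
    rest j l = σ (suc j) * (σ l * g (suc j) l)
    cancel : ∀ l → first l + rest l zero ≈ 0#
    cancel l = begin
      first l + rest l zero                       ≈⟨ +-cong (*-identityˡ _) (trans (σ-suc l _) (-‿cong (*-congˡ (*-identityˡ _)))) ⟩
      σ l * g zero l + - (σ l * g (suc l) zero)   ≈⟨ +-congʳ (*-congˡ (g-sym zero l)) ⟩
      σ l * g (suc l) zero + - (σ l * g (suc l) zero) ≈⟨ -‿inverseʳ _ ⟩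
      0# ∎
    double : ∀ j l → rest j (suc l) ≈ σ j * (σ l * g (suc j) (suc l))
    double j l = begin
      σ (suc j) * (σ (suc l) * x)  ≈⟨ σ-suc j _ ⟩
      - (σ j * (σ (suc l) * x))    ≈⟨ -‿cong (*-congˡ (σ-suc l x)) ⟩
      - (σ j * - (σ l * x))        ≈⟨ -‿cong (-‿distribʳ-* _ _) ⟨
      - - (σ j * (σ l * x))        ≈⟨ -‿involutive _ ⟩
      σ j * (σ l * x)              ∎
      where x = g (suc j) (suc l)

  module _ {n} (B : Fin n → Vector Carrier (suc (suc n))) where

    private
      minor : Fin (suc (suc n)) → Fin (suc n) → Carrier
      minor j l = Det λ i → removeAt (removeAt (B i) j) l

      term : (u v : Vector Carrier (suc (suc n))) → Fin (suc (suc n)) → Fin (suc n) → Carrier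
      term u v j l = u j * (v (punchIn j l) * minor j l)

      minor-partner : ∀ j l → minor j l ≈ minor (punchIn j l) (partner j l)
      minor-partner j l = det-cong λ i k → reflexive (≡.cong (B i) (punchIn-punchIn j l k))

      term-partner : ∀ u v j l → term u v j l ≈ term v u (punchIn j l) (partner j l)
      term-partner u v j l = begin
        u j * (v (punchIn j l) * minor j l)  ≈⟨ x∙yz≈y∙xz _ _ _ ⟩
        v (punchIn j l) * (u j * minor j l)  ≈⟨ *-congˡ (*-cong
                                                  (reflexive (≡.cong u (≡.sym (punchIn-partner j l)))) (minor-partner j l)) ⟩
        term v u (punchIn j l) (partner j l) ∎

    Δ-altSum : ∀ u v → Δ u (v ∷ B) ≈ altSum (term u v)
    Δ-altSum u v = trans (Δ-expand u (v ∷ B)) (∑-cong λ j → begin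
      σ j * (u j * Det (λ i → removeAt ((v ∷ B) i) j))
        ≈⟨ *-congˡ {x = σ j} (*-congˡ (trans (det-Δ _) (Δ-expand _ _))) ⟩
      σ j * (u j * ∑ (λ l → σ l * (v (punchIn j l) * minor j l)))
        ≈⟨ *-congˡ {x = σ j} (*-∑ (u j) _) ⟩
      σ j * ∑ (λ l → u j * (σ l * (v (punchIn j l) * minor j l)))
        ≈⟨ *-∑ (σ j) _ ⟩
      ∑ (λ l → σ j * (u j * (σ l * (v (punchIn j l) * minor j l))))
        ≈⟨ ∑-cong (λ l → *-congˡ {x = σ j} (x∙yz≈y∙xz _ _ _)) ⟩
      ∑ (λ l → σ j * (σ l * term u v j l)) ∎)

    Δ-equal : ∀ u → Δ u (u ∷ B) ≈ 0#
    Δ-equal u = trans (Δ-altSum u u) (altSum-symmetric _ (term-partner u u))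

    -- The partner of a pair turns `term u v` into `term v u`, so the sum of both is symmetric and
    -- its alternating sum vanishes.
    Δ-swap : ∀ u v → Δ u (v ∷ B) ≈ - Δ v (u ∷ B)
    Δ-swap u v = inverseˡ-unique _ _ (begin
      Δ u (v ∷ B) + Δ v (u ∷ B)
        ≈⟨ +-cong (Δ-altSum u v) (Δ-altSum v u) ⟩
      altSum (term u v) + altSum (term v u)
        ≈⟨ ∑-+ (λ j → ∑ λ l → σ j * (σ l * term u v j l)) _ ⟨
      (∑ λ j → (∑ λ l → σ j * (σ l * term u v j l)) + (∑ λ l → σ j * (σ l * term v u j l)))
        ≈⟨ ∑-cong (λ j → sym (∑-+ (λ l → σ j * (σ l * term u v j l)) _)) ⟩
      (∑ λ j → ∑ λ l → σ j * (σ l * term u v j l) + σ j * (σ l * term v u j l))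
        ≈⟨ ∑-cong (λ j → ∑-cong λ l → sym (trans (*-congˡ (distribˡ _ _ _)) (distribˡ _ _ _))) ⟩
      altSum (λ j l → term u v j l + term v u j l)
        ≈⟨ altSum-symmetric _ (λ j l → trans (+-cong (term-partner u v j l) (term-partner v u j l)) (+-comm _ _)) ⟩
      0# ∎)

  removeAt-suc : ∀ {n} {a} {X : Set a} (A : Vector X (suc (suc n))) j i →
    removeAt A (suc j) i ≡ (A zero ∷ removeAt (tail A) j) i
  removeAt-suc A j zero    = ≡.refl
  removeAt-suc A j (suc i) = ≡.refl

  -- The two lemmas recurse through each other: `row-to-top` swaps the chosen row with row `zero`
  -- and leaves the rest of the move to `row-to-second`, which carries it out inside each minor, as
  -- a `row-to-top` of smaller size.
  row-to-top : ∀ {n} (A : Matrix Carrier (suc n)) j → Δ (A j) (removeAt A j) ≈ σ j * Det A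
  row-to-second : ∀ {n} v (B : Fin (suc n) → Vector Carrier (suc (suc n))) j →
    Δ v (B j ∷ removeAt B j) ≈ σ j * Δ v B

  row-to-top         A zero    = sym (trans (*-identityˡ _) (det-Δ A))
  row-to-top {suc n} A (suc j) = begin
    Δ (A (suc j)) (removeAt A (suc j))
      ≈⟨ Δ-cong (λ _ → refl) (λ i k → reflexive (≡.cong (λ r → r k) (removeAt-suc A j i))) ⟩
    Δ (A (suc j)) (A zero ∷ removeAt (tail A) j)
      ≈⟨ Δ-swap _ _ _ ⟩
    - Δ (A zero) (A (suc j) ∷ removeAt (tail A) j)
      ≈⟨ -‿cong (row-to-second (A zero) (tail A) j) ⟩
    - (σ j * Δ (A zero) (tail A))
      ≈⟨ -‿cong (*-congˡ (det-Δ A)) ⟨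
    - (σ j * Det A)
      ≈⟨ σ-suc j _ ⟨
    σ (suc j) * Det A ∎

  row-to-second v B j = Δ-scale (σ j) v λ k → begin
    Det (λ i → removeAt ((B j ∷ removeAt B j) i) k)
      ≈⟨ det-Δ _ ⟩
    Δ (removeAt (B j) k) (λ i → removeAt (B (punchIn j i)) k)
      ≈⟨ row-to-top (λ i → removeAt (B i) k) j ⟩
    σ j * Det (λ i → removeAt (B i) k) ∎

  Δ-repeated : ∀ {n} (B : Fin n → Vector Carrier (suc n)) i → Δ (B i) B ≈ 0#
  Δ-repeated {suc n} B i = begin
    Δ (B i) B                                   ≈⟨ σ² i _ ⟨
    σ i * (σ i * Δ (B i) B)                     ≈⟨ *-congˡ (row-to-second (B i) B i) ⟨
    σ i * Δ (B i) (B i ∷ removeAt B i)          ≈⟨ *-congˡ (Δ-equal (removeAt B i) (B i)) ⟩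
    σ i * 0#                                    ≈⟨ zeroʳ _ ⟩
    0# ∎

  infix 8 _·_
  _·_ : ∀ {n} → Vector Carrier n → Vector Carrier n → Carrier
  u · v = ∑ λ k → u k * v k

  -- Column `j` of the adjugate, that is, a solution of A x = det A e_j; it is the concrete x to
  -- which the graph argument is applied.
  cofactor : ∀ {n} → Matrix Carrier (suc n) → Fin (suc n) → Vector Carrier (suc n)
  cofactor A j k = σ j * (σ k * Det λ i → removeAt (A (punchIn j i)) k)

  expand : ∀ {n} v (A : Matrix Carrier (suc n)) j → v · cofactor A j ≈ σ j * Δ v (removeAt A j)
  expand v A j = begin
    v · cofactor A j
      ≈⟨ ∑-cong (λ k → trans (x∙yz≈y∙xz _ _ _) (*-congˡ (x∙yz≈y∙xz _ _ _))) ⟩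
    (∑ λ k → σ j * (σ k * (v k * Det λ i → removeAt (A (punchIn j i)) k)))
      ≈⟨ *-∑ (σ j) _ ⟨
    σ j * (∑ λ k → σ k * (v k * Det λ i → removeAt (A (punchIn j i)) k))
      ≈⟨ *-congˡ (Δ-expand v (removeAt A j)) ⟨
    σ j * Δ v (removeAt A j) ∎

  expand-row : ∀ {n} (A : Matrix Carrier (suc n)) j → A j · cofactor A j ≈ Det A
  expand-row A j = begin
    A j · cofactor A j             ≈⟨ expand (A j) A j ⟩
    σ j * Δ (A j) (removeAt A j)   ≈⟨ *-congˡ (row-to-top A j) ⟩
    σ j * (σ j * Det A)            ≈⟨ σ² j _ ⟩
    Det A                          ∎

  -- This expands the determinant of `A` with row `j` overwritten by row `i`, which has a repeated
  -- row.
  expand-alien : ∀ {n} (A : Matrix Carrier (suc n)) {i j} → i ≢ j → A i · cofactor A j ≈ 0#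
  expand-alien A {i} {j} i≢j = begin
    A i · cofactor A j             ≈⟨ expand (A i) A j ⟩
    σ j * Δ (A i) (removeAt A j)   ≈⟨ *-congˡ (Δ-cong (λ k → reflexive (≡.cong (λ r → A r k) (≡.sym (punchIn-punchOut j≢i)))) λ _ _ → refl) ⟩
    σ j * Δ (removeAt A j (punchOut j≢i)) (removeAt A j) ≈⟨ *-congˡ (Δ-repeated (removeAt A j) _) ⟩
    σ j * 0#                       ≈⟨ zeroʳ _ ⟩
    0#                             ∎
    where
    j≢i : j ≢ i
    j≢i = i≢j ∘ ≡.sym

  cofactor-diagonal : ∀ {n} (A : Matrix Carrier (suc n)) j → cofactor A j j ≈ Det (delete A j)
  cofactor-diagonal A j = σ² j _

  -- The factor is the sign of `s` when `s` is a permutation and zero otherwise. What matters is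
  -- that it does not depend on `A`: a vanishing determinant makes every selection of rows,
  -- repetitions included, have determinant zero.
  det-reindex : ∀ {n} (s : Fin n → Fin n) → ∃[ ε ] ∀ A → Det (A ∘ s) ≈ ε * Det A
  det-reindex {zero}  s = 1# , λ A → trans (det-cong λ ()) (sym (*-identityˡ _))
  det-reindex {suc n} s with any? (λ i → s (suc i) ≟ s zero)
  ... | yes (i , sᵢ≡s₀) = 0# , λ A → begin
    Det (A ∘ s)                              ≈⟨ det-Δ (A ∘ s) ⟩
    Δ (A (s zero)) (A ∘ s ∘ suc)             ≈⟨ Δ-cong (λ k → reflexive (≡.cong (λ r → A r k) (≡.sym sᵢ≡s₀))) (λ _ _ → refl) ⟩
    Δ (A (s (suc i))) (A ∘ s ∘ suc)          ≈⟨ Δ-repeated (A ∘ s ∘ suc) i ⟩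
    0#                                       ≈⟨ zeroˡ _ ⟨
    0# * Det A                               ∎
  ... | no s₀-once = ε * σ (s zero) , λ A → begin
    Det (A ∘ s)
      ≈⟨ det-Δ (A ∘ s) ⟩
    Δ (A (s zero)) (A ∘ s ∘ suc)
      ≈⟨ Δ-cong (λ _ → refl) (λ i k → reflexive (≡.cong (λ r → A r k) (≡.sym (punchIn-punchOut (s₀≢ i))))) ⟩
    Δ (A (s zero)) (removeAt A (s zero) ∘ s′)
      ≈⟨ Δ-scale ε (A (s zero)) (λ k → reindexed λ i → removeAt (removeAt A (s zero) i) k) ⟩
    ε * Δ (A (s zero)) (removeAt A (s zero))
      ≈⟨ *-congˡ (row-to-top A (s zero)) ⟩
    ε * (σ (s zero) * Det A)
      ≈⟨ *-assoc _ _ _ ⟨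
    ε * σ (s zero) * Det A ∎
    where
    s₀≢ : ∀ i → s zero ≢ s (suc i)
    s₀≢ i eq = s₀-once (i , ≡.sym eq)
    s′ : Fin n → Fin n
    s′ i = punchOut (s₀≢ i)
    ε = proj₁ (det-reindex s′)
    reindexed = proj₂ (det-reindex s′)

  -- Rectangular, because `vanishing-minors` removes columns while keeping all rows.
  TrivialKernel : ∀ {p q} → (Fin q → Vector Carrier p) → Set _
  TrivialKernel A = ∀ x → (∀ i → A i · x ≈ 0#) → ∀ k → x k ≈ 0#

  -- If all maximal minors of A vanish, then so do all maximal minors of A
  -- without its first column: these are the first entries of kernel vectors of A
  -- made of signed minors.
  vanishing-minors : ∀ {p q} (A : Fin q → Vector Carrier p) → TrivialKernel A →
    (∀ s → Det (A ∘ s) ≈ 0#) → 1# ≈ 0#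
  -- Once all columns are gone, the empty minor is `1#` and yet vanishes.
  vanishing-minors {zero}  A trivial vanish = trans (sym (det-empty _)) (vanish λ ())
  vanishing-minors {suc p} A trivial vanish = vanishing-minors (tail ∘ A) trivial′ vanish′
    where
    trivial′ : TrivialKernel (tail ∘ A)
    trivial′ x Ax≈0 k = trivial (0# ∷ x)
      (λ i → trans (∑-suc _) (trans (+-cong (zeroʳ _) (Ax≈0 i)) (+-identityˡ 0#))) (suc k)
    vanish′ : ∀ s → Det (tail ∘ A ∘ s) ≈ 0#
    vanish′ s = trans (sym (*-identityˡ _)) (trivial y Ay≈0 zero)
      where
      y : Vector Carrier (suc p)
      y k = σ k * Det λ i → removeAt (A (s i)) k
      Ay≈0 : ∀ i → A i · y ≈ 0#
      Ay≈0 i = begin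
        A i · y                          ≈⟨ ∑-cong (λ k → x∙yz≈y∙xz _ _ _) ⟩
        (∑ λ k → σ k * (A i k * Det λ r → removeAt (A (s r)) k)) ≈⟨ Δ-expand (A i) (A ∘ s) ⟨
        Δ (A i) (A ∘ s)                  ≈⟨ det-Δ (A ∘ (i ∷ s)) ⟨
        Det (A ∘ (i ∷ s))                ≈⟨ vanish (i ∷ s) ⟩
        0#                               ∎

  trivial-kernel⇒det≉0 : ∀ {n} (A : Matrix Carrier n) → TrivialKernel A → ¬ (1# ≈ 0#) → ¬ (Det A ≈ 0#)
  trivial-kernel⇒det≉0 A trivial 1≉0 detA≈0 = 1≉0 (vanishing-minors A trivial λ s →
    trans (proj₂ (det-reindex s) A) (trans (*-congˡ detA≈0) (zeroʳ _)))

  module _ (D : Carrier → Carrier) (D-cong : ∀ {x y} → x ≈ y → D x ≈ D y)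
           (D-+ : ∀ x y → D (x + y) ≈ D x + D y)
           (D-* : ∀ x y → D (x * y) ≈ D x * y + x * D y) where

    private
      idempotent⇒0 : ∀ {x} → x ≈ x + x → x ≈ 0#
      idempotent⇒0 {x} eq = RingProperties.x+x≈x⇒x≈0 ring x (sym eq)

    D-0 : D 0# ≈ 0#
    D-0 = idempotent⇒0 (trans (D-cong (sym (+-identityˡ 0#))) (D-+ 0# 0#))

    D-1 : D 1# ≈ 0#
    D-1 = idempotent⇒0 (trans (D-cong (sym (*-identityˡ 1#)))
      (trans (D-* 1# 1#) (+-cong (*-identityʳ _) (*-identityˡ _))))

    D-neg : ∀ x → D (- x) ≈ - D x
    D-neg x = inverseˡ-unique _ _
      (trans (sym (D-+ (- x) x)) (trans (D-cong (-‿inverseˡ x)) D-0))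

    D-σ : ∀ {n} (j : Fin n) x → D (σ j * x) ≈ σ j * D x
    D-σ zero    x = trans (D-cong (*-identityˡ x)) (sym (*-identityˡ _))
    D-σ (suc j) x = begin
      D (σ (suc j) * x)  ≈⟨ D-cong (σ-suc j x) ⟩
      D (- (σ j * x))    ≈⟨ D-neg _ ⟩
      - D (σ j * x)      ≈⟨ -‿cong (D-σ j x) ⟩
      - (σ j * D x)      ≈⟨ σ-suc j _ ⟨
      σ (suc j) * D x    ∎

    D-sum : ∀ {n} (f : Vector Carrier n) → D (∑ f) ≈ ∑ (D ∘ f)
    D-sum {zero}  f = trans (D-cong (∑-empty f)) (trans D-0 (sym (∑-empty (D ∘ f))))
    D-sum {suc n} f = trans (D-cong (∑-suc f))
      (trans (D-+ _ _) (trans (+-congˡ (D-sum (tail f))) (sym (∑-suc (D ∘ f)))))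

    det-derivative-rows : ∀ {n} (A : Matrix Carrier n) →
      D (Det A) ≈ ∑ λ i → Det (updateAt A i (D ∘_))
    det-derivative-rows {zero}  A = trans (D-cong (det-empty A)) (trans D-1 (sym (∑-empty _)))
    det-derivative-rows {suc n} A = begin
      D (Det A)
        ≈⟨ D-cong (trans (det-Δ A) (Δ-expand _ _)) ⟩
      D (∑ λ j → σ j * (A zero j * minor j))
        ≈⟨ D-sum (λ j → σ j * (A zero j * minor j)) ⟩
      (∑ λ j → D (σ j * (A zero j * minor j)))
        ≈⟨ ∑-cong (λ j → trans (D-σ j _) (trans (*-congˡ (D-* _ _)) (distribˡ _ _ _))) ⟩
      (∑ λ j → σ j * (D (A zero j) * minor j) + σ j * (A zero j * D (minor j)))
        ≈⟨ ∑-+ (λ j → σ j * (D (A zero j) * minor j)) _ ⟩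
      (∑ λ j → σ j * (D (A zero j) * minor j)) + (∑ λ j → σ j * (A zero j * D (minor j)))
        ≈⟨ +-cong (sym (Δ-expand _ _)) (∑-cong inner) ⟩
      Δ (D ∘ A zero) (tail A) + (∑ λ j → ∑ λ i → σ j * (A zero j * Det (λ k → removeAt (updateAt (tail A) i (D ∘_) k) j)))
        ≈⟨ +-congˡ (∑-swap λ j i → σ j * (A zero j * Det (λ k → removeAt (updateAt (tail A) i (D ∘_) k) j))) ⟩
      Δ (D ∘ A zero) (tail A) + (∑ λ i → ∑ λ j → σ j * (A zero j * Det (λ k → removeAt (updateAt (tail A) i (D ∘_) k) j)))
        ≈⟨ +-cong (det-Δ (updateAt A zero (D ∘_))) (∑-cong λ i → trans (det-Δ (updateAt A (suc i) (D ∘_))) (Δ-expand _ _)) ⟨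
      Det (updateAt A zero (D ∘_)) + (∑ λ i → Det (updateAt A (suc i) (D ∘_)))
        ≈⟨ ∑-suc (λ i → Det (updateAt A i (D ∘_))) ⟨
      (∑ λ i → Det (updateAt A i (D ∘_))) ∎
      where
      minor : Fin (suc n) → Carrier
      minor j = Det λ i → removeAt (A (suc i)) j
      commute : ∀ {m} (B : Fin m → Vector Carrier (suc n)) i j k l →
        updateAt (λ r → removeAt (B r) j) i (D ∘_) k l ≡ removeAt (updateAt B i (D ∘_) k) j l
      commute {suc m} B zero    j zero    l = ≡.refl
      commute {suc m} B zero    j (suc k) l = ≡.refl
      commute {suc m} B (suc i) j zero    l = ≡.refl
      commute {suc m} B (suc i) j (suc k) l = commute (tail B) i j k l
      inner : ∀ j → σ j * (A zero j * D (minor j)) ≈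
        ∑ λ i → σ j * (A zero j * Det (λ k → removeAt (updateAt (tail A) i (D ∘_) k) j))
      inner j = begin
        σ j * (A zero j * D (minor j))
          ≈⟨ *-congˡ (*-congˡ (trans (det-derivative-rows _) (∑-cong λ i → det-cong λ k l → reflexive (commute (tail A) i j k l)))) ⟩
        σ j * (A zero j * ∑ (λ i → Det (λ k → removeAt (updateAt (tail A) i (D ∘_) k) j)))
          ≈⟨ *-congˡ (*-∑ (A zero j) _) ⟩
        σ j * ∑ (λ i → A zero j * Det (λ k → removeAt (updateAt (tail A) i (D ∘_) k) j))
          ≈⟨ *-∑ (σ j) _ ⟩
        ∑ (λ i → σ j * (A zero j * Det (λ k → removeAt (updateAt (tail A) i (D ∘_) k) j))) ∎

    -- Jacobi's formula: each summand of `det-derivative-rows` is expanded along its differentiated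
    -- row, whose cofactors do not see the change.
    det-derivative : ∀ {n} (A : Matrix Carrier (suc n)) →
      D (Det A) ≈ ∑ λ i → (D ∘ A i) · cofactor A i
    det-derivative {n} A = trans (det-derivative-rows A) (∑-cong λ i →
      trans (sym (expand-row (updateAt A i (D ∘_)) i)) (∑-cong λ k → *-cong
        (reflexive (≡.cong (λ r → r k) (updateAt-updates i A)))
        (*-congˡ {x = σ i} (*-congˡ {x = σ k} (det-cong λ l m → reflexive (≡.cong (λ r → r (punchIn k m))
          (updateAt-minimal (punchIn i l) i A (punchInᵢ≢i i l))))))))

module _ {c ℓ c′ ℓ′} (S : RawRing c′ ℓ′) (R : CommutativeRing c ℓ) where
  open CommutativeRing R hiding (zero)
  open Determinant R
  open RingMorphisms S rawRing using (IsRingHomomorphism)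
  private module S = RawRing S

  module _ {f : S.Carrier → Carrier} (hom : IsRingHomomorphism f) where
    open IsRingHomomorphism hom

    sum-homo : ∀ {n} (v : Vector S.Carrier n) → f (RawMonoidDefs.sum S.+-rawMonoid v) ≈ ∑ (f ∘ v)
    sum-homo {zero}  v = trans 0#-homo (sym (∑-empty (f ∘ v)))
    sum-homo {suc n} v = trans (+-homo _ _) (trans (+-congˡ (sum-homo (tail v))) (sym (∑-suc (f ∘ v))))

    sign-homo : ∀ {n} (j : Fin n) → f (RawSemiringDefs._^_ S.rawSemiring (S.- S.1#) (toℕ j)) ≈ σ j
    sign-homo zero    = 1#-homo
    sign-homo (suc j) = trans (*-homo _ _) (*-cong (trans (-‿homo _) (-‿cong 1#-homo)) (sign-homo j))

    -- The source is only a raw ring, which admits coefficient lists: along `coeff` the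
    -- characteristic polynomial becomes a determinant of series. Along the constant term,
    -- determinants of series become scalar determinants.
    det-homo : ∀ {n} (A : Matrix S.Carrier n) → f (det S A) ≈ Det (λ i j → f (A i j))
    det-homo {zero}  A = trans 1#-homo (sym (det-empty _))
    det-homo {suc n} A = trans (sum-homo _) (trans
      (∑-cong λ j → trans (*-homo _ _) (*-cong (sign-homo j) (trans (*-homo _ _) (*-congˡ (det-homo _)))))
      (sym (trans (det-Δ _) (Δ-expand _ _))))

-- The ring of formal power series and its derivation

module PowerSeries {c ℓ} (R : CommutativeRing c ℓ) where
  open CommutativeRing R hiding (zero)
  open NaturalSolver commutativeSemiring using (solve; con; _:=_; _:+_; _:*_)
  open SemiringMult semiring using (×-congʳ; ×-comm-*) renaming (_×_ to _×ᶜ_)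
  open CommutativeMonoidMult +-commutativeMonoid using (×-distrib-+)
  open CSP +-commutativeSemigroup using (x∙yz≈y∙xz; interchange)
  open import Relation.Binary.Reasoning.Setoid setoid

  Series : Set c
  Series = ℕ → Carrier

  shift : Series → Series
  shift f k = f (suc k)

  infixl 7 _⊛_
  _⊛_ : Series → Series → Series
  (f ⊛ g) zero    = f 0 * g 0
  (f ⊛ g) (suc k) = f 0 * g (suc k) + (shift f ⊛ g) k

  𝟙 : Series
  𝟙 zero    = 1#
  𝟙 (suc k) = 0#

  ⊛-cong : ∀ {f f′ g g′} → (∀ k → f k ≈ f′ k) → (∀ k → g k ≈ g′ k) → ∀ k → (f ⊛ g) k ≈ (f′ ⊛ g′) k
  ⊛-cong f≈ g≈ zero    = *-cong (f≈ 0) (g≈ 0)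
  ⊛-cong f≈ g≈ (suc k) = +-cong (*-cong (f≈ 0) (g≈ (suc k))) (⊛-cong (f≈ ∘ suc) g≈ k)

  ⊛-zeroˡ : ∀ {f} → (∀ k → f k ≈ 0#) → ∀ g k → (f ⊛ g) k ≈ 0#
  ⊛-zeroˡ f≈0 g zero    = trans (*-congʳ (f≈0 0)) (zeroˡ _)
  ⊛-zeroˡ f≈0 g (suc k) = trans (+-cong (trans (*-congʳ (f≈0 0)) (zeroˡ _)) (⊛-zeroˡ (f≈0 ∘ suc) g k)) (+-identityˡ _)

  ⊛-identityˡ : ∀ g k → (𝟙 ⊛ g) k ≈ g k
  ⊛-identityˡ g zero    = *-identityˡ _
  ⊛-identityˡ g (suc k) = trans (+-cong (*-identityˡ _) (⊛-zeroˡ (λ _ → refl) g k)) (+-identityʳ _)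

  -- `_⊛_` recurses on its left factor; this is the mirrored recursion. It yields commutativity,
  -- after which one-sided laws suffice.
  ⊛-sucʳ : ∀ f g k → (f ⊛ g) (suc k) ≈ g 0 * f (suc k) + (f ⊛ shift g) k
  ⊛-sucʳ f g zero    = trans (+-comm _ _) (+-congʳ (*-comm _ _))
  ⊛-sucʳ f g (suc k) = trans (+-congˡ (⊛-sucʳ (shift f) g k)) (x∙yz≈y∙xz _ _ _)

  ⊛-comm : ∀ f g k → (f ⊛ g) k ≈ (g ⊛ f) k
  ⊛-comm f g zero    = *-comm _ _
  ⊛-comm f g (suc k) = trans (+-congˡ (⊛-comm (shift f) g k)) (sym (⊛-sucʳ g f k))

  ⊛-distribʳ : ∀ h f g k → ((λ i → f i + g i) ⊛ h) k ≈ (f ⊛ h) k + (g ⊛ h) k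
  ⊛-distribʳ h f g zero    = distribʳ _ _ _
  ⊛-distribʳ h f g (suc k) = trans (+-cong (distribʳ _ _ _) (⊛-distribʳ h (shift f) (shift g) k)) (interchange _ _ _ _)

  ⊛-scaleˡ : ∀ a g h k → ((λ i → a * g i) ⊛ h) k ≈ a * (g ⊛ h) k
  ⊛-scaleˡ a g h zero    = *-assoc _ _ _
  ⊛-scaleˡ a g h (suc k) = trans (+-cong (*-assoc _ _ _) (⊛-scaleˡ a (shift g) h k)) (sym (distribˡ _ _ _))

  ⊛-assoc : ∀ f g h k → ((f ⊛ g) ⊛ h) k ≈ (f ⊛ (g ⊛ h)) k
  ⊛-assoc f g h zero    = *-assoc _ _ _
  ⊛-assoc f g h (suc k) = begin
    f 0 * g 0 * h (suc k) + ((λ i → f 0 * g (suc i) + (shift f ⊛ g) i) ⊛ h) k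
      ≈⟨ +-cong (*-assoc _ _ _) (trans (⊛-distribʳ h _ _ k) (+-cong (⊛-scaleˡ (f 0) (shift g) h k) (⊛-assoc (shift f) g h k))) ⟩
    f 0 * (g 0 * h (suc k)) + (f 0 * (shift g ⊛ h) k + (shift f ⊛ (g ⊛ h)) k)
      ≈⟨ trans (sym (+-assoc _ _ _)) (+-congʳ (sym (distribˡ _ _ _))) ⟩
    f 0 * (g ⊛ h) (suc k) + (shift f ⊛ (g ⊛ h)) k ∎

  seriesRing : CommutativeRing c ℓ
  seriesRing = record
    { Carrier = Series
    ; _≈_ = λ f g → ∀ k → f k ≈ g k
    ; _+_ = λ f g k → f k + g k
    ; _*_ = _⊛_
    ; -_  = λ f k → - f k
    ; 0#  = λ _ → 0#
    ; 1#  = 𝟙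
    ; isCommutativeRing = record
      { isRing = record
        { +-isAbelianGroup = Pointwise.isAbelianGroup ℕ +-isAbelianGroup
        ; *-cong     = ⊛-cong
        ; *-assoc    = ⊛-assoc
        ; *-identity = ⊛-identityˡ , λ f k → trans (⊛-comm f 𝟙 k) (⊛-identityˡ f k)
        ; distrib    = (λ f g h k → trans (⊛-comm f _ k) (trans (⊛-distribʳ f g h k)
                         (+-cong (⊛-comm g f k) (⊛-comm h f k))))
                     , ⊛-distribʳ
        }
      ; *-comm = ⊛-comm
      }
    }

  private module Series = CommutativeRing seriesRing

  open RingMorphisms Series.rawRing rawRing using ()
    renaming (IsRingHomomorphism to IsConstantTermHomomorphism)

  constantTerm-homo : IsConstantTermHomomorphism (λ f → f 0)
  constantTerm-homo = record
    { isSemiringHomomorphism = record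
      { isNearSemiringHomomorphism = record
        { +-isMonoidHomomorphism = record
          { isMagmaHomomorphism = record
            { isRelHomomorphism = record { cong = λ f≈g → f≈g 0 }
            ; homo = λ _ _ → refl
            }
          ; ε-homo = refl
          }
        ; *-homo = λ _ _ → refl
        }
      ; 1#-homo = refl
      }
    ; -‿homo = λ _ → refl
    }

  ∂ : Series → Series
  ∂ f k = suc k ×ᶜ f (suc k)

  ∂-cong : ∀ {f g} → (∀ k → f k ≈ g k) → ∀ k → ∂ f k ≈ ∂ g k
  ∂-cong f≈g k = ×-congʳ (suc k) (f≈g (suc k))

  ∂-+ : ∀ f g k → ∂ (λ i → f i + g i) k ≈ ∂ f k + ∂ g k
  ∂-+ f g k = ×-distrib-+ _ _ (suc k)

  -- Induction along f = f 0 + X · `shift f`, whose derivative is `shift f` + X · `∂ (shift f)`;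
  -- `step` is the latter identity multiplied by `g`.
  ∂-⊛ : ∀ f g k → ∂ (f ⊛ g) k ≈ (∂ f ⊛ g) k + (f ⊛ ∂ g) k
  ∂-⊛ f g zero = solve 4 (λ a b c d → (a :* d :+ b :* c) :+ con 0 := (b :+ con 0) :* c :+ a :* (d :+ con 0)) refl
    (f 0) (f 1) (g 0) (g 1)
  ∂-⊛ f g (suc k) = begin
    (f 0 * g (suc (suc k)) + (shift f ⊛ g) (suc k)) + suc k ×ᶜ (f 0 * g (suc (suc k)) + (shift f ⊛ g) (suc k))
      ≈⟨ +-congˡ (trans (×-distrib-+ _ _ (suc k)) (+-cong (sym (×-comm-* (suc k) _ _)) (∂-⊛ (shift f) g k))) ⟩
    (f 0 * g (suc (suc k)) + (shift f ⊛ g) (suc k)) +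
      (f 0 * ∂ (shift g) k + ((∂ (shift f) ⊛ g) k + (shift f ⊛ ∂ g) k))
      ≈⟨ solve 6 (λ a b c d x y → (a :* b :+ d) :+ (a :* c :+ (x :+ y)) := (d :+ x) :+ (a :* (b :+ c) :+ y)) refl
           (f 0) (g (suc (suc k))) (∂ (shift g) k) ((shift f ⊛ g) (suc k)) ((∂ (shift f) ⊛ g) k) ((shift f ⊛ ∂ g) k) ⟩
    ((shift f ⊛ g) (suc k) + (∂ (shift f) ⊛ g) k) + (f ⊛ ∂ g) (suc k)
      ≈⟨ +-congʳ step ⟨
    (∂ f ⊛ g) (suc k) + (f ⊛ ∂ g) (suc k) ∎
    where
    step : (∂ f ⊛ g) (suc k) ≈ (shift f ⊛ g) (suc k) + (∂ (shift f) ⊛ g) k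
    step = begin
      (f 1 + 0#) * g (suc k) + ((λ i → f (suc (suc i)) + ∂ (shift f) i) ⊛ g) k
        ≈⟨ +-cong (*-congʳ (+-identityʳ _)) (⊛-distribʳ g _ _ k) ⟩
      f 1 * g (suc k) + ((shift (shift f) ⊛ g) k + (∂ (shift f) ⊛ g) k)
        ≈⟨ +-assoc _ _ _ ⟨
      (shift f ⊛ g) (suc k) + (∂ (shift f) ⊛ g) k ∎

-- The multiplicity of 0 as the order of the characteristic series

module Multiplicity {c ℓ} (R : CommutativeRing c ℓ) where
  open CommutativeRing R hiding (zero)
  open Polynomial rawRing
  open PowerSeries R
  open RingProperties ring using (-0#≈0#)
  open SemiringMult semiring using () renaming (_×_ to _×ᶜ_)
  open import Relation.Binary.Reasoning.Setoid setoid
  private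
    module Series where
      open CommutativeRing seriesRing public
      open Determinant seriesRing public
  open Determinant R

  coeff-+ : ∀ p q k → coeff (p +ₚ q) k ≈ coeff p k + coeff q k
  coeff-+ List.[]       q              k       = sym (+-identityˡ _)
  coeff-+ (a List.∷ p) List.[]        k       = sym (+-identityʳ _)
  coeff-+ (a List.∷ p) (b List.∷ q)  zero    = refl
  coeff-+ (a List.∷ p) (b List.∷ q)  (suc k) = coeff-+ p q k

  coeff-scale : ∀ a p k → coeff (List.map (a *_) p) k ≈ a * coeff p k
  coeff-scale a List.[]       k       = sym (zeroʳ a)
  coeff-scale a (b List.∷ p) zero    = refl
  coeff-scale a (b List.∷ p) (suc k) = coeff-scale a p k

  coeff-neg : ∀ p k → coeff (List.map -_ p) k ≈ - coeff p k
  coeff-neg List.[]       k       = sym -0#≈0#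
  coeff-neg (a List.∷ p) zero    = refl
  coeff-neg (a List.∷ p) (suc k) = coeff-neg p k

  coeff-* : ∀ p q k → coeff (p *ₚ q) k ≈ (coeff p ⊛ coeff q) k
  coeff-* List.[]       q k       = sym (⊛-zeroˡ (λ _ → refl) (coeff q) k)
  coeff-* (a List.∷ p) q zero    = trans (coeff-+ (List.map (a *_) q) _ 0) (trans (+-identityʳ _) (coeff-scale a q 0))
  coeff-* (a List.∷ p) q (suc k) = trans (coeff-+ (List.map (a *_) q) _ (suc k))
    (+-cong (coeff-scale a q (suc k)) (coeff-* p q k))

  coeff-1 : ∀ k → coeff (1# List.∷ List.[]) k ≈ 𝟙 k
  coeff-1 zero    = refl
  coeff-1 (suc k) = refl

  open RingMorphisms polyRing Series.rawRing using ()
    renaming (IsRingHomomorphism to IsCoefficientHomomorphism)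

  coeff-homo : IsCoefficientHomomorphism coeff
  coeff-homo = record
    { isSemiringHomomorphism = record
      { isNearSemiringHomomorphism = record
        { +-isMonoidHomomorphism = record
          { isMagmaHomomorphism = record
            { isRelHomomorphism = record { cong = λ p≈q → p≈q }
            ; homo = coeff-+
            }
          ; ε-homo = λ _ → refl
          }
        ; *-homo = coeff-*
        }
      ; 1#-homo = coeff-1
      }
    ; -‿homo = coeff-neg
    }

  X⊛-zero : ∀ f → (coeff (X- 0#) ⊛ f) 0 ≈ 0#
  X⊛-zero f = trans (*-congʳ -0#≈0#) (zeroˡ _)

  X⊛-suc : ∀ f k → (coeff (X- 0#) ⊛ f) (suc k) ≈ f k
  X⊛-suc f k = begin
    - 0# * f (suc k) + (coeff (1# List.∷ List.[]) ⊛ f) k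
      ≈⟨ +-cong (trans (*-congʳ -0#≈0#) (zeroˡ _)) (trans (⊛-cong coeff-1 (λ _ → refl) k) (⊛-identityˡ f k)) ⟩
    0# + f k  ≈⟨ +-identityˡ _ ⟩
    f k       ∎

  Order : Series → ℕ → Set ℓ
  Order f k = (∀ i → i < k → f i ≈ 0#) × ¬ (f k ≈ 0#)

  order-unique : ∀ {f k l} → Order f k → Order f l → k ≡ l
  order-unique {k = k} {l} (low , fk≉0) (low′ , fl≉0) with ℕ.<-cmp k l
  ... | tri< k<l _ _ = contradiction (low′ k k<l) fk≉0
  ... | tri≈ _ eq _  = eq
  ... | tri> _ _ l<k = contradiction (low l l<k) fl≉0

  order-resp : ∀ {f g k} → (∀ i → f i ≈ g i) → Order f k → Order g k
  order-resp f≈g (low , fk≉0) = (λ i i<k → trans (sym (f≈g i)) (low i i<k)) , λ gk≈0 → fk≉0 (trans (f≈g _) gk≈0)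

  coeff-Xᵏ⁺¹ : ∀ k q i → coeff ((X- 0#) ^ₚ suc k *ₚ q) i ≈ (coeff (X- 0#) ⊛ coeff ((X- 0#) ^ₚ k *ₚ q)) i
  coeff-Xᵏ⁺¹ k q i = begin
    coeff ((X- 0#) ^ₚ suc k *ₚ q) i
      ≈⟨ coeff-* ((X- 0#) ^ₚ suc k) q i ⟩
    (coeff ((X- 0#) ^ₚ suc k) ⊛ coeff q) i
      ≈⟨ ⊛-cong (coeff-* (X- 0#) ((X- 0#) ^ₚ k)) (λ _ → refl) i ⟩
    ((coeff (X- 0#) ⊛ coeff ((X- 0#) ^ₚ k)) ⊛ coeff q) i
      ≈⟨ ⊛-assoc (coeff (X- 0#)) (coeff ((X- 0#) ^ₚ k)) (coeff q) i ⟩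
    (coeff (X- 0#) ⊛ (coeff ((X- 0#) ^ₚ k) ⊛ coeff q)) i
      ≈⟨ ⊛-cong (λ _ → refl) (λ l → sym (coeff-* ((X- 0#) ^ₚ k) q l)) i ⟩
    (coeff (X- 0#) ⊛ coeff ((X- 0#) ^ₚ k *ₚ q)) i ∎

  coeff-X⁰ : ∀ q i → coeff ((X- 0#) ^ₚ 0 *ₚ q) i ≈ coeff q i
  coeff-X⁰ q i = trans (coeff-* (1# List.∷ List.[]) q i)
    (trans (⊛-cong coeff-1 (λ _ → refl) i) (⊛-identityˡ (coeff q) i))

  coeff-Xᵏ : ∀ k q → (∀ i → i < k → coeff ((X- 0#) ^ₚ k *ₚ q) i ≈ 0#) × coeff ((X- 0#) ^ₚ k *ₚ q) k ≈ coeff q 0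
  coeff-Xᵏ zero    q = (λ _ ()) , coeff-X⁰ q 0
  coeff-Xᵏ (suc k) q = low , trans (coeff-Xᵏ⁺¹ k q (suc k)) (trans (X⊛-suc _ k) (proj₂ (coeff-Xᵏ k q)))
    where
    low : ∀ i → i < suc k → coeff ((X- 0#) ^ₚ suc k *ₚ q) i ≈ 0#
    low zero    _         = trans (coeff-Xᵏ⁺¹ k q 0) (X⊛-zero (coeff ((X- 0#) ^ₚ k *ₚ q)))
    low (suc i) (s≤s i<k) = trans (coeff-Xᵏ⁺¹ k q (suc i)) (trans (X⊛-suc _ i) (proj₁ (coeff-Xᵏ k q) i i<k))

  eval-0 : ∀ q → eval q 0# ≈ coeff q 0
  eval-0 List.[]       = refl
  eval-0 (a List.∷ q) = trans (+-congˡ (zeroˡ _)) (+-identityʳ a)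

  -- The entries of `X I - A`. Their constant terms are the entries of -A, which is why the
  -- arguments below run with -A in place of A.
  charEntry : ∀ {n} → Matrix Carrier n → Matrix Series n
  charEntry A i j = coeff (if does (i ≟ j) then X- (A i j) else - A i j List.∷ List.[])

  charEntry-0 : ∀ {n} (A : Matrix Carrier n) i j → charEntry A i j 0 ≡ - A i j
  charEntry-0 A i j with does (i ≟ j)
  ... | true  = ≡.refl
  ... | false = ≡.refl

  charEntry-diagonal : ∀ {n} (A : Matrix Carrier n) i → charEntry A i i ≡ coeff (X- (A i i))
  charEntry-diagonal A i rewrite dec-true (i ≟ i) ≡.refl = ≡.refl

  charEntry-offDiagonal : ∀ {n} (A : Matrix Carrier n) {i j} → i ≢ j → charEntry A i j ≡ coeff (- A i j List.∷ List.[])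
  charEntry-offDiagonal A {i} {j} i≢j rewrite dec-false (i ≟ j) i≢j = ≡.refl

  χ : ∀ {n} → Matrix Carrier n → Series
  χ A = Series.Det (charEntry A)

  coeff-charPoly : ∀ {n} (A : Matrix Carrier n) k → coeff (charPoly A) k ≈ χ A k
  coeff-charPoly A k = det-homo polyRing seriesRing coeff-homo _ k

  AlgMult⇒Order : ∀ {n} (A : Matrix Carrier n) {k} → AlgMult A 0# k → Order (χ A) k
  AlgMult⇒Order A {k} (q , χ≈ , q₀≉0) = order-resp (coeff-charPoly A)
    ( (λ i i<k → trans (χ≈ i) (proj₁ (coeff-Xᵏ k q) i i<k))
    , λ χₖ≈0 → q₀≉0 (trans (eval-0 q) (trans (sym (proj₂ (coeff-Xᵏ k q))) (trans (sym (χ≈ k)) χₖ≈0))))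

  -- The quotient is `p` without its first `k` coefficients, all of which vanish.
  factor : ∀ k p → Order (coeff p) k → ∃[ q ] (p ≈ₚ (X- 0#) ^ₚ k *ₚ q × ¬ (eval q 0# ≈ 0#))
  factor zero    p (_ , p₀≉0) = p , (λ i → sym (coeff-X⁰ p i)) , λ eval≈0 → p₀≉0 (trans (sym (eval-0 p)) eval≈0)
  factor (suc k) List.[]       (_ , 0≉0) = contradiction refl 0≉0
  factor (suc k) (a List.∷ p) (low , pₖ≉0) with factor k p ((λ i i<k → low (suc i) (s≤s i<k)) , pₖ≉0)
  ... | q , p≈ , q≉0 = q , (λ i → trans (head-tail i) (sym (trans (coeff-Xᵏ⁺¹ k q i)
        (⊛-cong (λ _ → refl) (λ l → sym (p≈ l)) i)))) , q≉0
    where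
    head-tail : ∀ i → coeff (a List.∷ p) i ≈ (coeff (X- 0#) ⊛ coeff p) i
    head-tail zero    = trans (low 0 (s≤s z≤n)) (sym (X⊛-zero (coeff p)))
    head-tail (suc i) = sym (X⊛-suc (coeff p) i)

  Order⇒AlgMult : ∀ {n} (A : Matrix Carrier n) {k} → Order (χ A) k → AlgMult A 0# k
  Order⇒AlgMult A {k} ord = factor k (charPoly A) (order-resp (λ i → sym (coeff-charPoly A i)) ord)

  constantTerm-det : ∀ {n} (L : Matrix Series n) → Series.Det L 0 ≈ Det (λ i j → L i j 0)
  constantTerm-det L = trans (reflexive (≡.cong (λ f → f 0) (Series.Det≡det L)))
    (det-homo Series.rawRing R constantTerm-homo L)

  χ-0 : ∀ {n} (A : Matrix Carrier n) → χ A 0 ≈ Det (λ i j → - A i j)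
  χ-0 A = trans (constantTerm-det (charEntry A)) (det-cong λ i j → reflexive (charEntry-0 A i j))

  constantTerm-cofactor : ∀ {n} (A : Matrix Carrier (suc n)) k l →
    Series.cofactor (charEntry A) k l 0 ≈ cofactor (λ i j → - A i j) k l
  constantTerm-cofactor A k l = *-cong (sign k) (*-cong (sign l) (trans
    (constantTerm-det (λ i → removeAt (charEntry A (punchIn k i)) l))
    (det-cong λ i j → reflexive (charEntry-0 A (punchIn k i) (punchIn l j)))))
    where
    sign : ∀ {n} (i : Fin n) → Series.σ i 0 ≈ σ i
    sign = sign-homo Series.rawRing R constantTerm-homo

  ∑-coefficient : ∀ {m} (f : Fin m → Series) k → Series.∑ f k ≈ ∑ λ i → f i k
  ∑-coefficient {zero}  f k = trans (Series.∑-empty f k) (sym (∑-empty _))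
  ∑-coefficient {suc m} f k = trans (Series.∑-suc f k) (trans (+-congˡ (∑-coefficient (f ∘ suc) k)) (sym (∑-suc _)))

  charEntry-delete : ∀ {n} (A : Matrix Carrier (suc n)) r i j k →
    charEntry (delete A r) i j k ≈ delete (charEntry A) r i j k
  charEntry-delete A r i j k with i ≟ j
  ... | yes ≡.refl = reflexive (≡.sym (≡.cong (λ f → f k) (charEntry-diagonal A (punchIn r i))))
  ... | no i≢j     = reflexive (≡.sym (≡.cong (λ f → f k) (charEntry-offDiagonal A (i≢j ∘ punchIn-injective r i j))))

  ×-zero : ∀ k → k ×ᶜ 0# ≈ 0#
  ×-zero zero    = refl
  ×-zero (suc k) = trans (+-identityˡ _) (×-zero k)

  ∂-diagonal : ∀ {n} (A : Matrix Carrier n) i k → ∂ (charEntry A i i) k ≈ 𝟙 k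
  ∂-diagonal A i k rewrite charEntry-diagonal A i = lemma k
    where
    lemma : ∀ k → ∂ (coeff (X- (A i i))) k ≈ 𝟙 k
    lemma zero    = +-identityʳ 1#
    lemma (suc k) = ×-zero (suc (suc k))

  ∂-offDiagonal : ∀ {n} (A : Matrix Carrier n) {i j} → i ≢ j → ∀ k → ∂ (charEntry A i j) k ≈ 0#
  ∂-offDiagonal A i≢j k rewrite charEntry-offDiagonal A i≢j = ×-zero (suc k)

  -- In `X I - A` only the diagonal entries depend on the variable, with derivative `𝟙`, so Jacobi's
  -- formula keeps only the diagonal cofactor of each row.
  ∂χ : ∀ {n} (A : Matrix Carrier (suc n)) k → ∂ (χ A) k ≈ ∑ λ i → χ (delete A i) k
  ∂χ A k = trans (Series.trans
      (Series.det-derivative ∂ ∂-cong ∂-+ ∂-⊛ (charEntry A))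
      (Series.∑-cong term) k) (∑-coefficient _ k)
    where
    term : ∀ i → (∂ ∘ charEntry A i) Series.· Series.cofactor (charEntry A) i Series.≈ χ (delete A i)
    term i = Series.trans
      (Series.∑-single _ i λ j j≢i → Series.trans (Series.*-congʳ (∂-offDiagonal A (j≢i ∘ ≡.sym))) (Series.zeroˡ _))
      (Series.trans (Series.*-congʳ (∂-diagonal A i))
      (Series.trans (Series.*-identityˡ _)
      (Series.trans (Series.cofactor-diagonal (charEntry A) i)
      (Series.det-cong λ a b → Series.sym (charEntry-delete A i a b)))))

-- P-vertices of symmetric matrices over an ordered field

module PVertices {c ℓ₁ ℓ₂} (ℝ : RealField c ℓ₁ ℓ₂) where
  open RealField ℝ using (_<ʳ_; 0≉1; inverse; isStrictTotalOrder; +-monoˡ-<; *-pos; compare; commutativeRing)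
  open IsStrictTotalOrder isStrictTotalOrder using (irrefl; <-resp-≈) renaming (trans to <-trans; _≟_ to _≈?_)
  open CommutativeRing commutativeRing hiding (zero)
  open RingProperties ring using (-1*x≈-x; -‿distribˡ-*; -‿distribʳ-*; -‿involutive)
    renaming (+-inverseˡ-unique to inverseˡ-unique)
  open CSP *-commutativeSemigroup using (x∙yz≈y∙xz)
  open SemiringMult semiring using (×-assoc-*; ×-congʳ) renaming (_×_ to _×ᶜ_)
  open Multiplicity commutativeRing
  open PowerSeries commutativeRing
  open Determinant commutativeRing
  open import Relation.Binary.Reasoning.Setoid setoid
  private
    module Series where
      open CommutativeRing seriesRing public
      open Determinant seriesRing public

  1≉0 : ¬ (1# ≈ 0#)
  1≉0 = 0≉1 ∘ sym

  <-respʳ : ∀ {x y z} → y ≈ z → x <ʳ y → x <ʳ z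
  <-respʳ = proj₁ <-resp-≈

  <-respˡ : ∀ {x y z} → y ≈ z → y <ʳ x → z <ʳ x
  <-respˡ = proj₂ <-resp-≈

  pos⇒≉0 : ∀ {x} → 0# <ʳ x → ¬ (x ≈ 0#)
  pos⇒≉0 0<x x≈0 = irrefl (sym x≈0) 0<x

  +-pos : ∀ {x y} → 0# <ʳ x → 0# <ʳ y → 0# <ʳ x + y
  +-pos {x} {y} 0<x 0<y = <-trans 0<y (<-respˡ (+-identityˡ y) (+-monoˡ-< y 0<x))

  neg-pos : ∀ {x} → x <ʳ 0# → 0# <ʳ - x
  neg-pos {x} x<0 = <-respʳ (+-identityˡ _) (<-respˡ (-‿inverseʳ x) (+-monoˡ-< (- x) x<0))

  square-pos : ∀ {x} → ¬ (x ≈ 0#) → 0# <ʳ x * x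
  square-pos {x} x≉0 with compare 0# x
  ... | tri< 0<x _ _ = *-pos 0<x 0<x
  ... | tri≈ _ 0≈x _ = contradiction (sym 0≈x) x≉0
  ... | tri> _ _ x<0 = <-respʳ -x*-x≈x*x (*-pos (neg-pos x<0) (neg-pos x<0))
    where
    -x*-x≈x*x : - x * - x ≈ x * x
    -x*-x≈x*x = trans (sym (-‿distribˡ-* _ _)) (trans (-‿cong (sym (-‿distribʳ-* _ _))) (-‿involutive _))

  1-pos : 0# <ʳ 1#
  1-pos = <-respʳ (*-identityˡ 1#) (square-pos 1≉0)

  norm-pos : ∀ {n} (u : Vector Carrier n) → (∀ i → u i ≈ 0#) ⊎ 0# <ʳ u · u
  norm-pos {zero}  u = inj₁ λ ()
  norm-pos {suc n} u with u zero ≈? 0# | norm-pos (tail u)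
  ... | yes u₀≈0 | inj₁ u⁺≈0 = inj₁ λ { zero → u₀≈0 ; (suc i) → u⁺≈0 i }
  ... | yes u₀≈0 | inj₂ 0<u²  = inj₂ (<-respʳ (sym (trans (∑-suc _)
                                 (trans (+-congʳ (trans (*-congʳ u₀≈0) (zeroˡ _))) (+-identityˡ _)))) 0<u²)
  ... | no  u₀≉0 | inj₁ u⁺≈0 = inj₂ (<-respʳ (sym (trans (∑-suc _)
                                 (trans (+-congˡ (∑-zero λ i → trans (*-congʳ (u⁺≈0 i)) (zeroˡ _))) (+-identityʳ _)))) (square-pos u₀≉0))
  ... | no  u₀≉0 | inj₂ 0<u²  = inj₂ (<-respʳ (sym (∑-suc _)) (+-pos (square-pos u₀≉0) 0<u²))

  norm-zero : ∀ {n} (u : Vector Carrier n) → u · u ≈ 0# → ∀ i → u i ≈ 0#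
  norm-zero u u·u≈0 with norm-pos u
  ... | inj₁ u≈0 = u≈0
  ... | inj₂ 0<u² = contradiction u·u≈0 (pos⇒≉0 0<u²)

  *-cancel-0 : ∀ {x y} → ¬ (x ≈ 0#) → x * y ≈ 0# → y ≈ 0#
  *-cancel-0 {x} {y} x≉0 xy≈0 with inverse x x≉0
  ... | x⁻¹ , xx⁻¹≈1 = begin
    y              ≈⟨ *-identityˡ y ⟨
    1# * y         ≈⟨ *-congʳ (trans (*-comm _ _) xx⁻¹≈1) ⟨
    x⁻¹ * x * y    ≈⟨ *-assoc _ _ _ ⟩
    x⁻¹ * (x * y)  ≈⟨ *-congˡ xy≈0 ⟩
    x⁻¹ * 0#       ≈⟨ zeroʳ _ ⟩
    0#             ∎

  -- Characteristic zero, from the order: it recovers a coefficient of a series from a coefficient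
  -- of the derivative.
  ×-cancel-0 : ∀ n {x} → suc n ×ᶜ x ≈ 0# → x ≈ 0#
  ×-cancel-0 n {x} nx≈0 = *-cancel-0 (pos⇒≉0 (multiple-pos n))
    (trans (×-assoc-* (suc n) 1# x) (trans (×-congʳ (suc n) (*-identityˡ x)) nx≈0))
    where
    multiple-pos : ∀ n → 0# <ʳ suc n ×ᶜ 1#
    multiple-pos zero    = <-respʳ (sym (+-identityʳ _)) 1-pos
    multiple-pos (suc n) = +-pos 1-pos (multiple-pos n)

  self-adjoint : ∀ {n} {B : Matrix Carrier n} → (∀ i j → B i j ≈ B j i) → ∀ u v →
    (∑ λ i → u i * (B i · v)) ≈ ∑ λ i → (B i · u) * v i
  self-adjoint {B = B} B-sym u v = begin
    (∑ λ i → u i * (B i · v))                ≈⟨ ∑-cong (λ i → *-∑ (u i) _) ⟩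
    (∑ λ i → ∑ λ j → u i * (B i j * v j))    ≈⟨ ∑-swap _ ⟩
    (∑ λ j → ∑ λ i → u i * (B i j * v j))    ≈⟨ ∑-cong (λ j → ∑-cong λ i → rearrange i j) ⟩
    (∑ λ j → ∑ λ i → v j * (B j i * u i))    ≈⟨ ∑-cong (λ j → trans (sym (*-∑ (v j) _)) (*-comm _ _)) ⟩
    (∑ λ j → (B j · u) * v j)                ∎
    where
    rearrange : ∀ i j → u i * (B i j * v j) ≈ v j * (B j i * u i)
    rearrange i j = begin
      u i * (B i j * v j)  ≈⟨ *-comm _ _ ⟩
      B i j * v j * u i    ≈⟨ *-congʳ (trans (*-congʳ (B-sym i j)) (*-comm _ _)) ⟩
      v j * B j i * u i    ≈⟨ *-assoc _ _ _ ⟩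
      v j * (B j i * u i)  ∎

  allPVertices⇒det≉0 : ∀ {n} (A : Matrix Carrier (suc n)) → (∀ j → PVertex ℝ A j) →
    ¬ (Det (λ i j → - A i j) ≈ 0#)
  allPVertices⇒det≉0 A pv = by-order (proj₁ (pv zero)) (AlgMult⇒Order A (proj₁ (proj₂ (pv zero))))
    where
    by-order : ∀ k → Order (χ A) k → ¬ (Det (λ i j → - A i j) ≈ 0#)
    by-order zero    (_ , χ₀≉0) det≈0 = χ₀≉0 (trans (χ-0 A) det≈0)
    by-order (suc k) ord@(_ , χ≉0) _ = χ≉0 (×-cancel-0 k (trans (∂χ A k) (∑-zero vanish)))
      where
      vanish : ∀ i → χ (delete A i) k ≈ 0#
      vanish i with pv i
      -- The multiplicity `l` carried by `pv i` is a priori unrelated to the one carried by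
      -- `pv zero`; uniqueness of the order identifies them.
      ... | l , multA , multAᵢ with order-unique {f = χ A} {k = l} {l = suc k} (AlgMult⇒Order A multA) ord
      ...   | ≡.refl = proj₁ (AlgMult⇒Order (delete A i) multAᵢ) k (s≤s (ℕ.n≤1+n k))

  -- Every solution x of (B x)ᵢ = 0 for i ≠ j has xⱼ = 0: for invertible B this
  -- says that the inverse of B has zero diagonal.
  InverseDiagonalZero : ∀ {n} → Matrix Carrier n → Set _
  InverseDiagonalZero B = ∀ j x → (∀ i → i ≢ j → B i · x ≈ 0#) → x j ≈ 0#

  -- Compare the coefficients of 1 and X in (X - A) adj(X - A) = χ_A I: with b₀ and
  -- b₁ the first two coefficients of a column of the adjugate, A b₀ = 0 and
  -- b₀ = A b₁, so that b₀ · b₀ = A b₀ · b₁ = 0.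
  double-root⇒cofactors-zero : ∀ {n} (A : Matrix Carrier (suc n)) → (∀ i j → A i j ≈ A j i) →
    χ A 0 ≈ 0# → χ A 1 ≈ 0# → ∀ k l → cofactor (λ i j → - A i j) k l ≈ 0#
  double-root⇒cofactors-zero A A-sym χ₀≈0 χ₁≈0 k l =
    trans (sym (constantTerm-cofactor A k l)) (norm-zero b₀ b₀·b₀≈0 l)
    where
    B : Matrix Carrier _
    B i j = - A i j
    b : Vector Series _
    b = Series.cofactor (charEntry A) k
    b₀ b₁ : Vector Carrier _
    b₀ i = b i 0
    b₁ i = b i 1

    rows : ∀ i → (charEntry A i Series.· b) 0 ≈ 0# × (charEntry A i Series.· b) 1 ≈ 0#
    rows i with i ≟ k
    ... | yes ≡.refl = trans (Series.expand-row (charEntry A) i 0) χ₀≈0 , trans (Series.expand-row (charEntry A) i 1) χ₁≈0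
    ... | no i≢k     = Series.expand-alien (charEntry A) i≢k 0 , Series.expand-alien (charEntry A) i≢k 1

    Bb₀≈0 : ∀ i → B i · b₀ ≈ 0#
    Bb₀≈0 i = trans (∑-cong λ j → *-congʳ (reflexive (≡.sym (charEntry-0 A i j))))
      (trans (sym (∑-coefficient _ 0)) (proj₁ (rows i)))

    linear : ∀ i → (∑ λ j → charEntry A i j 1 * b₀ j) ≈ b₀ i
    linear i = trans
      -- `∂ f 0` unfolds to `f 1 + 0#`, so the linear coefficients of the entries, which form the
      -- identity matrix, are read off from the derivative.
      (∑-single _ i λ j j≢i → trans (*-congʳ (trans (sym (+-identityʳ _)) (∂-offDiagonal A (j≢i ∘ ≡.sym) 0))) (zeroˡ _))
      (trans (*-congʳ (trans (sym (+-identityʳ _)) (∂-diagonal A i 0))) (*-identityˡ _))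

    Bb₁≈-b₀ : ∀ i → B i · b₁ ≈ - b₀ i
    Bb₁≈-b₀ i = inverseˡ-unique _ _ (begin
      B i · b₁ + b₀ i
        ≈⟨ +-cong (∑-cong λ j → *-congʳ (reflexive (≡.sym (charEntry-0 A i j)))) (sym (linear i)) ⟩
      (∑ λ j → charEntry A i j 0 * b₁ j) + (∑ λ j → charEntry A i j 1 * b₀ j)
        ≈⟨ ∑-+ _ _ ⟨
      (∑ λ j → charEntry A i j 0 * b₁ j + charEntry A i j 1 * b₀ j)
        ≈⟨ ∑-coefficient _ 1 ⟨
      (charEntry A i Series.· b) 1
        ≈⟨ proj₂ (rows i) ⟩
      0# ∎)

    b₀·b₀≈0 : b₀ · b₀ ≈ 0#
    b₀·b₀≈0 = begin
      b₀ · b₀                                 ≈⟨ ∑-cong (λ i → trans (sym (-‿involutive _))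
                                                 (-‿cong (trans (-‿distribʳ-* _ _) (*-congˡ (sym (Bb₁≈-b₀ i)))))) ⟩
      (∑ λ i → - (b₀ i * (B i · b₁)))         ≈⟨ ∑-cong (λ i → -‿distribˡ-* _ _) ⟩
      (∑ λ i → - b₀ i * (B i · b₁))           ≈⟨ self-adjoint (λ i j → -‿cong (A-sym i j)) (λ i → - b₀ i) b₁ ⟩
      (∑ λ i → (B i · λ j → - b₀ j) * b₁ i)   ≈⟨ ∑-zero (λ i → trans (*-congʳ (B-b₀≈0 i)) (zeroˡ _)) ⟩
      0#                                      ∎
      where
      B-b₀≈0 : ∀ i → (B i · λ j → - b₀ j) ≈ 0#
      B-b₀≈0 i = begin
        (∑ λ j → B i j * - b₀ j)        ≈⟨ ∑-cong (λ j → trans (sym (-‿distribʳ-* _ _)) (sym (-1*x≈-x _))) ⟩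
        (∑ λ j → - 1# * (B i j * b₀ j)) ≈⟨ *-∑ (- 1#) _ ⟨
        - 1# * (B i · b₀)               ≈⟨ *-congˡ (Bb₀≈0 i) ⟩
        - 1# * 0#                       ≈⟨ zeroʳ _ ⟩
        0#                              ∎

  -- If all cofactors vanish at a root of order two or more, then so does the
  -- determinant of -M with row k replaced by the kernel vector y, although that
  -- matrix has trivial kernel as soon as y k is nonzero.
  kernel-line⇒simple-root : ∀ {n} (M : Matrix Carrier n) → (∀ i j → M i j ≈ M j i) →
    (y : Vector Carrier n) → (∀ i → (λ j → - M i j) · y ≈ 0#) → ¬ (∀ k → y k ≈ 0#) →
    ∀ d → ¬ (d ≈ 0#) →
    (∀ z → (∀ i → (λ j → - M i j) · z ≈ 0#) → ∃[ t ] ∀ l → d * z l ≈ t * y l) →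
    χ M 0 ≈ 0# → ¬ (χ M 1 ≈ 0#)
  kernel-line⇒simple-root {zero}  M M-sym y My≈0 y≉0 d d≉0 line χ₀≈0 χ₁≈0 = y≉0 λ ()
  kernel-line⇒simple-root {suc n} M M-sym y My≈0 y≉0 d d≉0 line χ₀≈0 χ₁≈0 = y≉0 vanish
    where
    B : Matrix Carrier (suc n)
    B i j = - M i j
    module _ (k : Fin (suc n)) (yₖ≉0 : ¬ (y k ≈ 0#)) where
      W : Matrix Carrier (suc n)
      -- Putting `y` on top instead of in row `k` only costs the sign `σ k`.
      W = y ∷ removeAt B k

      detW≈0 : Det W ≈ 0#
      detW≈0 = begin
        Det W                              ≈⟨ det-Δ W ⟩
        Δ y (removeAt B k)                 ≈⟨ σ² k _ ⟨
        σ k * (σ k * Δ y (removeAt B k))   ≈⟨ *-congˡ (expand y B k) ⟨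
        σ k * (y · cofactor B k)           ≈⟨ *-congˡ (∑-zero λ l → trans (*-congˡ
                                                (double-root⇒cofactors-zero M M-sym χ₀≈0 χ₁≈0 k l)) (zeroʳ _)) ⟩
        σ k * 0#                           ≈⟨ zeroʳ _ ⟩
        0#                                 ∎

      trivialW : TrivialKernel W
      trivialW z Wz≈0 l = *-cancel-0 d≉0 (trans (dz≈ty l) (trans (*-congʳ t≈0) (zeroˡ _)))
        where
        Bz≈0-off : ∀ i → i ≢ k → B i · z ≈ 0#
        Bz≈0-off i i≢k with punchOut (i≢k ∘ ≡.sym) | punchIn-punchOut (i≢k ∘ ≡.sym)
        ... | r | ≡.refl = Wz≈0 (suc r)
        -- `W` lacks row `k` of `B`. By symmetry y · Bz = By · z = 0, and the only surviving term on
        -- the left is the one at `k`.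
        Bₖz≈0 : B k · z ≈ 0#
        Bₖz≈0 = *-cancel-0 yₖ≉0 (begin
          y k * (B k · z)               ≈⟨ ∑-single _ k (λ i i≢k → trans (*-congˡ (Bz≈0-off i i≢k)) (zeroʳ _)) ⟨
          (∑ λ i → y i * (B i · z))     ≈⟨ self-adjoint (λ i j → -‿cong (M-sym i j)) y z ⟩
          (∑ λ i → (B i · y) * z i)     ≈⟨ ∑-zero (λ i → trans (*-congʳ (My≈0 i)) (zeroˡ _)) ⟩
          0#                            ∎)
        Bz≈0 : ∀ i → B i · z ≈ 0#
        Bz≈0 i with i ≟ k
        ... | yes ≡.refl = Bₖz≈0
        ... | no  i≢k    = Bz≈0-off i i≢k
        t : Carrier
        t = proj₁ (line z Bz≈0)
        dz≈ty : ∀ l → d * z l ≈ t * y l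
        dz≈ty = proj₂ (line z Bz≈0)
        -- The top row of `W` makes `z` orthogonal to `y`, while `d` times `z` is `t` times `y`.
        t≈0 : t ≈ 0#
        t≈0 = *-cancel-0 (λ y·y≈0 → yₖ≉0 (norm-zero y y·y≈0 k)) (begin
          (y · y) * t                   ≈⟨ *-comm _ _ ⟩
          t * (y · y)                   ≈⟨ *-∑ t _ ⟩
          (∑ λ l → t * (y l * y l))     ≈⟨ ∑-cong (λ l → trans (x∙yz≈y∙xz _ _ _) (*-congˡ (sym (dz≈ty l)))) ⟩
          (∑ λ l → y l * (d * z l))     ≈⟨ ∑-cong (λ l → x∙yz≈y∙xz _ _ _) ⟩
          (∑ λ l → d * (y l * z l))     ≈⟨ *-∑ d _ ⟨
          d * (y · z)                   ≈⟨ *-congˡ (Wz≈0 zero) ⟩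
          d * 0#                        ≈⟨ zeroʳ _ ⟩
          0#                            ∎)

    vanish : ∀ k → y k ≈ 0#
    vanish k with y k ≈? 0#
    ... | yes yₖ≈0 = yₖ≈0
    ... | no  yₖ≉0 = contradiction (detW≈0 k yₖ≉0) (trivial-kernel⇒det≉0 (W k yₖ≉0) (trivialW k yₖ≉0) 1≉0)

  module _ {n} (A : Matrix Carrier (suc n)) (A-sym : ∀ i j → A i j ≈ A j i)
           (diagonal-zero : InverseDiagonalZero (λ i j → - A i j)) where

    private
      B : Matrix Carrier (suc n)
      B i j = - A i j

      B-sym : ∀ i j → B i j ≈ B j i
      B-sym i j = -‿cong (A-sym i j)

    trivialKernel : TrivialKernel B
    trivialKernel x Bx≈0 j = diagonal-zero j x λ i _ → Bx≈0 i

    det≉0 : ¬ (Det B ≈ 0#)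
    det≉0 = trivial-kernel⇒det≉0 B trivialKernel 1≉0

    module _ (j : Fin (suc n)) where
      private
        x : Vector Carrier (suc n)
        x = cofactor B j

        y : Vector Carrier n
        y = removeAt x j

        M : Matrix Carrier n
        M = delete A j

        Bⱼ : Matrix Carrier n
        Bⱼ i l = - M i l

      -- The entry `x j` is a diagonal cofactor, the determinant of B(j); its vanishing makes 0 a
      -- root for the deleted matrix.
      xⱼ≈0 : x j ≈ 0#
      xⱼ≈0 = diagonal-zero j x λ i i≢j → expand-alien B i≢j

      row-delete : ∀ i z → z j ≈ 0# → B i · z ≈ ∑ λ l → B i (punchIn j l) * z (punchIn j l)
      row-delete i z zⱼ≈0 = trans (∑-remove _ j)
        (trans (+-congʳ (trans (*-congˡ zⱼ≈0) (zeroʳ _))) (+-identityˡ _))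

      y-kernel : ∀ i → Bⱼ i · y ≈ 0#
      y-kernel i = trans (sym (row-delete (punchIn j i) x xⱼ≈0)) (expand-alien B (punchInᵢ≢i j i))

      y≉0 : ¬ (∀ k → y k ≈ 0#)
      y≉0 y≈0 = det≉0 (trans (sym (expand-row B j)) (trans (row-delete j x xⱼ≈0)
        (∑-zero λ l → trans (*-congˡ (y≈0 l)) (zeroʳ _))))

      -- Padding `z` with a zero at `j` gives B z⁺ = t e_j, while B x = det B e_j; so det B z⁺ - t x
      -- lies in the trivial kernel of `B`.
      kernel-line : ∀ z → (∀ i → Bⱼ i · z ≈ 0#) → ∃[ t ] ∀ l → Det B * z l ≈ t * y l
      kernel-line z Bⱼz≈0 = t , λ l → begin
        Det B * z l                   ≈⟨ *-congˡ (reflexive (insertAt-punchIn z j 0# l)) ⟨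
        Det B * z⁺ (punchIn j l)      ≈⟨ difference-zero (punchIn j l) ⟩
        t * y l                       ∎
        where
        z⁺ : Vector Carrier (suc n)
        z⁺ = insertAt z j 0#
        z⁺ⱼ≈0 : z⁺ j ≈ 0#
        z⁺ⱼ≈0 = reflexive (insertAt-lookup z j 0#)
        t : Carrier
        t = B j · z⁺
        w : Vector Carrier (suc n)
        w l = Det B * z⁺ l + - t * x l
        Bz⁺≈0 : ∀ i → i ≢ j → B i · z⁺ ≈ 0#
        Bz⁺≈0 i i≢j with punchOut (i≢j ∘ ≡.sym) | punchIn-punchOut (i≢j ∘ ≡.sym)
        ... | r | ≡.refl = trans (row-delete (punchIn j r) z⁺ z⁺ⱼ≈0)
          (trans (∑-cong λ l → *-congˡ (reflexive (insertAt-punchIn z j 0# l))) (Bⱼz≈0 r))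
        Bw : ∀ i → B i · w ≈ Det B * (B i · z⁺) + - t * (B i · x)
        Bw i = begin
          B i · w
            ≈⟨ ∑-cong (λ l → trans (distribˡ _ _ _) (+-cong (x∙yz≈y∙xz _ _ _) (x∙yz≈y∙xz _ _ _))) ⟩
          (∑ λ l → Det B * (B i l * z⁺ l) + - t * (B i l * x l))
            ≈⟨ ∑-+ _ _ ⟩
          (∑ λ l → Det B * (B i l * z⁺ l)) + (∑ λ l → - t * (B i l * x l))
            ≈⟨ +-cong (*-∑ (Det B) _) (*-∑ (- t) _) ⟨
          Det B * (B i · z⁺) + - t * (B i · x) ∎
        Bw≈0 : ∀ i → B i · w ≈ 0#
        Bw≈0 i with i ≟ j
        ... | no i≢j = trans (Bw i) (trans (+-cong (trans (*-congˡ (Bz⁺≈0 i i≢j)) (zeroʳ _))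
                                                   (trans (*-congˡ (expand-alien B i≢j)) (zeroʳ _))) (+-identityˡ _))
        ... | yes ≡.refl = trans (Bw i) (trans (+-cong (*-comm _ _)
                                                   (trans (*-congˡ (expand-row B i)) (sym (-‿distribˡ-* _ _)))) (-‿inverseʳ _))
        difference-zero : ∀ l → Det B * z⁺ l ≈ t * x l
        difference-zero l = begin
          Det B * z⁺ l      ≈⟨ inverseˡ-unique _ _ (trivialKernel w Bw≈0 l) ⟩
          - (- t * x l)     ≈⟨ -‿cong (-‿distribˡ-* _ _) ⟨
          - - (t * x l)     ≈⟨ -‿involutive _ ⟩
          t * x l           ∎

      pVertex : PVertex ℝ A j
      pVertex = 0
        , Order⇒AlgMult A ((λ _ ()) , λ χ₀≈0 → det≉0 (trans (sym (χ-0 A)) χ₀≈0))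
        , Order⇒AlgMult M ((λ { zero _ → χ₀≈0 ; (suc _) (s≤s ()) }) ,
            kernel-line⇒simple-root M (λ i l → A-sym _ _) y y-kernel y≉0 (Det B) det≉0 kernel-line χ₀≈0)
        where
        χ₀≈0 : χ M 0 ≈ 0#
        χ₀≈0 = trans (χ-0 M) (trans (sym (cofactor-diagonal B j)) xⱼ≈0)

-- Least witnesses, parity, and steps around the cycle

open import Data.Nat.Base using (_+_; _*_)

least : ∀ {p} {Q : ℕ → Set p} → Decidable Q → ∀ b → Q b →
  ∃[ d ] (d ≤ b × Q d × ∀ e → e < d → ¬ Q e)
least {Q = Q} Q? = <-rec _ search
  where
  search : ∀ b → (∀ {e} → e < b → Q e → ∃[ d ] (d ≤ e × Q d × ∀ e → e < d → ¬ Q e)) →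
    Q b → ∃[ d ] (d ≤ b × Q d × ∀ e → e < d → ¬ Q e)
  search b rec Qb with ℕ.anyUpTo? Q? b
  ... | no none            = b , ℕ.≤-refl , Qb , λ e e<b Qe → none (e , e<b , Qe)
  ... | yes (e , e<b , Qe) with rec e<b Qe
  ...   | d , d≤e , Qd , smaller = d , ℕ.≤-trans d≤e (ℕ.<⇒≤ e<b) , Qd , smaller

odd-form : ∀ d → Odd d → ∃[ t ] d ≡ suc (t * 2)
odd-form d odd = d / 2 , ≡.trans (m≡m%n+[m/n]*n d 2) (≡.cong (_+ d / 2 * 2) odd)

even-form : ∀ d → ¬ Odd d → ∃[ t ] d ≡ t * 2
even-form d ¬odd = d / 2 , ≡.trans (m≡m%n+[m/n]*n d 2) (≡.cong (_+ d / 2 * 2) (remainder (d % 2) (m%n<n d 2) ¬odd))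
  where
  remainder : ∀ r → r < 2 → r ≢ 1 → r ≡ 0
  remainder 0             _               _   = ≡.refl
  remainder 1             _               r≢1 = contradiction ≡.refl r≢1
  remainder (suc (suc _)) (s≤s (s≤s ())) _

module _ {n : ℕ} where
  private N = suc n

  toℕ-⊕ : ∀ (u : Fin N) d → toℕ (u ⊕ d) ≡ (toℕ u + d) % N
  toℕ-⊕ u d = Fin.toℕ-fromℕ< _

  [m%n+o]%n : ∀ a b → (a % N + b) % N ≡ (a + b) % N
  [m%n+o]%n a b = ≡.trans (%-distribˡ-+ (a % N) b N)
    (≡.trans (≡.cong (λ r → (r + b % N) % N) (m%n%n≡m%n a N)) (≡.sym (%-distribˡ-+ a b N)))

  ⊕-assoc : ∀ (u : Fin N) a b → u ⊕ a ⊕ b ≡ u ⊕ (a + b)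
  ⊕-assoc u a b = Fin.toℕ-injective (begin
    toℕ (u ⊕ a ⊕ b)              ≡⟨ toℕ-⊕ (u ⊕ a) b ⟩
    (toℕ (u ⊕ a) + b) % N        ≡⟨ ≡.cong (λ r → (r + b) % N) (toℕ-⊕ u a) ⟩
    ((toℕ u + a) % N + b) % N    ≡⟨ [m%n+o]%n (toℕ u + a) b ⟩
    (toℕ u + a + b) % N          ≡⟨ ≡.cong (_% N) (ℕ.+-assoc (toℕ u) a b) ⟩
    (toℕ u + (a + b)) % N        ≡⟨ toℕ-⊕ u (a + b) ⟨
    toℕ (u ⊕ (a + b))            ∎)
    where open ≡.≡-Reasoning

  ⊕-N : ∀ (u : Fin N) → u ⊕ N ≡ u
  ⊕-N u = Fin.toℕ-injective (≡.trans (toℕ-⊕ u N)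
    (≡.trans ([m+n]%n≡m%n (toℕ u) N) (m<n⇒m%n≡m (Fin.toℕ<n u))))

  ⊕-0 : ∀ (u : Fin N) → u ⊕ 0 ≡ u
  ⊕-0 u = Fin.toℕ-injective (≡.trans (toℕ-⊕ u 0)
    (≡.trans (≡.cong (_% N) (ℕ.+-identityʳ (toℕ u))) (m<n⇒m%n≡m (Fin.toℕ<n u))))

  ⊕1-injective : ∀ {u v : Fin N} → u ⊕ 1 ≡ v ⊕ 1 → u ≡ v
  ⊕1-injective {u} {v} eq = ≡.trans (≡.sym (round u)) (≡.trans (≡.cong (_⊕ n) eq) (round v))
    where
    round : ∀ w → w ⊕ 1 ⊕ n ≡ w
    round w = ≡.trans (⊕-assoc w 1 n) (⊕-N w)

  private
    u+[a+[N∸u]] : ∀ (u : Fin N) a → toℕ u + (a + (N ∸ toℕ u)) ≡ a + N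
    u+[a+[N∸u]] u a = begin
      toℕ u + (a + (N ∸ toℕ u))   ≡⟨ ≡.cong (toℕ u +_) (ℕ.+-comm a _) ⟩
      toℕ u + (N ∸ toℕ u + a)     ≡⟨ ℕ.+-assoc (toℕ u) _ a ⟨
      toℕ u + (N ∸ toℕ u) + a     ≡⟨ ≡.cong (_+ a) (ℕ.m+[n∸m]≡n (ℕ.<⇒≤ (Fin.toℕ<n u))) ⟩
      N + a                       ≡⟨ ℕ.+-comm N a ⟩
      a + N                       ∎
      where open ≡.≡-Reasoning

  -- Walking on by `N ∸ toℕ u` steps leads to the vertex with index `a`, which recovers the offset.
  ⊕-injective : ∀ (u : Fin N) a b → a < N → b < N → u ⊕ a ≡ u ⊕ b → a ≡ b
  ⊕-injective u a b a<N b<N eq = ≡.trans (≡.sym (offset a<N)) (≡.trans (≡.cong (λ v → toℕ (v ⊕ (N ∸ toℕ u))) eq) (offset b<N))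
    where
    offset : ∀ {a} → a < N → toℕ (u ⊕ a ⊕ (N ∸ toℕ u)) ≡ a
    offset {a} a<N = begin
      toℕ (u ⊕ a ⊕ (N ∸ toℕ u))         ≡⟨ ≡.cong toℕ (⊕-assoc u a _) ⟩
      toℕ (u ⊕ (a + (N ∸ toℕ u)))       ≡⟨ toℕ-⊕ u _ ⟩
      (toℕ u + (a + (N ∸ toℕ u))) % N   ≡⟨ ≡.cong (_% N) (u+[a+[N∸u]] u a) ⟩
      (a + N) % N                       ≡⟨ [m+n]%n≡m%n a N ⟩
      a % N                             ≡⟨ m<n⇒m%n≡m a<N ⟩
      a                                 ∎
      where open ≡.≡-Reasoning

  reach : ∀ (u v : Fin N) → ∃[ e ] (e < N × v ≡ u ⊕ e)
  reach u v = e , m%n<n (toℕ v + (N ∸ toℕ u)) N , Fin.toℕ-injective (begin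
    toℕ v                                     ≡⟨ m<n⇒m%n≡m {n = N} (Fin.toℕ<n v) ⟨
    toℕ v % N                                 ≡⟨ [m+n]%n≡m%n (toℕ v) N ⟨
    (toℕ v + N) % N                           ≡⟨ ≡.cong (_% N) (u+[a+[N∸u]] u (toℕ v)) ⟨
    (toℕ u + (toℕ v + (N ∸ toℕ u))) % N       ≡⟨ ≡.cong (_% N) (ℕ.+-comm (toℕ u) _) ⟩
    (toℕ v + (N ∸ toℕ u) + toℕ u) % N         ≡⟨ [m%n+o]%n (toℕ v + (N ∸ toℕ u)) (toℕ u) ⟨
    (e + toℕ u) % N                           ≡⟨ ≡.cong (_% N) (ℕ.+-comm e (toℕ u)) ⟩
    (toℕ u + e) % N                           ≡⟨ toℕ-⊕ u e ⟨
    toℕ (u ⊕ e)                               ∎)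
    where
    open ≡.≡-Reasoning
    e = (toℕ v + (N ∸ toℕ u)) % N

-- Arcs between hosts and the propagation of zeros

module Arcs {n m} (host : Fin m ↣ Fin (suc n)) where
  open Injection host using (to; injective)
  open ConsecutiveHosts
  private N = suc n

  NonHost : Fin N → Set
  NonHost v = ∀ k → to k ≢ v

  opaque
    nextHost : ∀ i → ∃[ d ] ∃[ j ] ConsecutiveHosts host i j d
    -- The shift by one excludes distance zero; after `suc n` steps the walk is back at host `i`,
    -- which bounds the search.
    nextHost i with least (λ d → Fin.any? λ k → to k Fin.≟ to i ⊕ suc d) n (i , ≡.sym (⊕-N (to i)))
    ... | d , _ , (j , j-reached) , smaller = suc d , j , record
      { positive = z<s
      ; reached  = j-reached
      ; first    = λ { (suc e) _ (s<s e<d) k eq → smaller e e<d (k , eq) }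
      }

  length≤ : ∀ {i j d} → ConsecutiveHosts host i j d → d ≤ N
  length≤ {i} c = ℕ.≮⇒≥ λ N<d → first c N z<s N<d i (≡.sym (⊕-N (to i)))

  opaque
    -- Minimising the distance to `u` over all hosts selects the nearest one behind `u`: a host
    -- passed on the way, or at `u` itself, would be nearer.
    previousHost : Fin m → ∀ u → ∃[ i ] ∃[ p ] (u ≡ to i ⊕ p × ∀ e → 0 < e → e ≤ p → NonHost (to i ⊕ e))
    previousHost k u with reach (to k) u
    ... | b , _ , u≡ with least (λ p → Fin.any? λ i → u Fin.≟ to i ⊕ p) b (k , u≡)
    ...   | p , _ , (i , u≡i⊕p) , smaller = i , p , u≡i⊕p , nonHost
      where
      nonHost : ∀ e → 0 < e → e ≤ p → NonHost (to i ⊕ e)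
      nonHost e 0<e e≤p l l≡ = smaller (p ∸ e) (ℕ.∸-monoʳ-< 0<e e≤p) (l , (begin
        u                         ≡⟨ u≡i⊕p ⟩
        to i ⊕ p                  ≡⟨ ≡.cong (to i ⊕_) (ℕ.m+[n∸m]≡n e≤p) ⟨
        to i ⊕ (e + (p ∸ e))      ≡⟨ ⊕-assoc (to i) e (p ∸ e) ⟨
        to i ⊕ e ⊕ (p ∸ e)        ≡⟨ ≡.cong (_⊕ (p ∸ e)) l≡ ⟨
        to l ⊕ (p ∸ e)            ∎))
        where open ≡.≡-Reasoning

  -- An arc from a host back to itself is a full turn, and a second host would interrupt it.
  distinct-ends : ∀ {i j d} → ∃[ k ] k ≢ i → ConsecutiveHosts host i j d → i ≢ j
  distinct-ends {i} {d = d} (k , k≢i) c ≡.refl with reach (to i) (to k)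
  ... | zero  , _   , k≡ = k≢i (injective (≡.trans k≡ (⊕-0 (to i))))
  ... | suc e , e<N , k≡ with suc e ℕ.<? d
  ...   | yes e<d = first c (suc e) z<s e<d k k≡
  ...   | no  e≮d = contradiction (⊕-injective (to i) 0 d z<s (ℕ.≤-<-trans (ℕ.≮⇒≥ e≮d) e<N) (≡.trans (⊕-0 (to i)) (reached c)))
                      (ℕ.<⇒≢ (positive c))

  private
    V = Fin N ⊎ Fin m
    _~_ : V → V → Set
    _~_ = C N ·P₁ host

  -- Z v stands for "the vector x vanishes at v" and E w for "the w-th entry of
  -- A x vanishes", where A is a matrix with graph _~_.
  module Propagation {z e} (Z : V → Set z) (E : V → Set e)
    (force : ∀ {w v₀} → w ~ v₀ → (∀ v → w ~ v → v ≢ v₀ → Z v) → E w → Z v₀) where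

    host-zero : ∀ {k} → E (inj₂ k) → Z (inj₁ (to k))
    host-zero = force ≡.refl λ { (inj₁ v) ≡.refl v≢v → contradiction ≡.refl v≢v ; (inj₂ _) () _ }

    -- Such a vertex has only neighbours on the cycle, so its equation passes a zero from one side
    -- to the other.
    Interior : Fin N → Set e
    Interior v = NonHost v × E (inj₁ v)

    step-forward : ∀ v → Interior (v ⊕ 1) → Z (inj₁ v) → Z (inj₁ (v ⊕ 1 ⊕ 1))
    step-forward v (nonHost , Ev) Zv = force (inj₁ ≡.refl) neighbours Ev
      where
      neighbours : ∀ u → inj₁ (v ⊕ 1) ~ u → u ≢ inj₁ (v ⊕ 1 ⊕ 1) → Z u
      neighbours (inj₁ u) (inj₁ u≡) u≢ = contradiction (≡.cong inj₁ u≡) u≢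
      neighbours (inj₁ u) (inj₂ eq) _  = ≡.subst (Z ∘ inj₁) (⊕1-injective eq) Zv
      neighbours (inj₂ k) eq        _  = contradiction (≡.sym eq) (nonHost k)

    step-backward : ∀ v → Interior (v ⊕ 1) → Z (inj₁ (v ⊕ 1 ⊕ 1)) → Z (inj₁ v)
    step-backward v (nonHost , Ev) Zv = force (inj₂ ≡.refl) neighbours Ev
      where
      neighbours : ∀ u → inj₁ (v ⊕ 1) ~ u → u ≢ inj₁ v → Z u
      neighbours (inj₁ u) (inj₁ u≡) _  = ≡.subst (Z ∘ inj₁) (≡.sym u≡) Zv
      neighbours (inj₁ u) (inj₂ eq) u≢ = contradiction (≡.cong inj₁ (≡.sym (⊕1-injective eq))) u≢
      neighbours (inj₂ k) eq        _  = contradiction (≡.sym eq) (nonHost k)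

    forward : ∀ s t → (∀ e → 0 < e → e < t * 2 → Interior (s ⊕ e)) →
      Z (inj₁ s) → Z (inj₁ (s ⊕ (t * 2)))
    forward s zero    int Zs = ≡.subst (Z ∘ inj₁) (≡.sym (⊕-0 s)) Zs
    forward s (suc t) int Zs = ≡.subst (Z ∘ inj₁) (⊕-assoc s 2 (t * 2))
      (forward (s ⊕ 2) t
        (λ e 0<e e<t → ≡.subst Interior (≡.sym (⊕-assoc s 2 e)) (int (2 + e) z<s (s<s (s<s e<t))))
        (≡.subst (Z ∘ inj₁) (⊕-assoc s 1 1) (step-forward s (int 1 z<s (s<s z<s)) Zs)))

    backward : ∀ s t → (∀ e → 0 < e → e < t * 2 → Interior (s ⊕ e)) →
      Z (inj₁ (s ⊕ (t * 2))) → Z (inj₁ s)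
    backward s zero    int Zs = ≡.subst (Z ∘ inj₁) (⊕-0 s) Zs
    backward s (suc t) int Zs = step-backward s (int 1 z<s (s<s z<s))
      (≡.subst (Z ∘ inj₁) (≡.sym (⊕-assoc s 1 1))
        (backward (s ⊕ 2) t
          (λ e 0<e e<t → ≡.subst Interior (≡.sym (⊕-assoc s 2 e)) (int (2 + e) z<s (s<s (s<s e<t))))
          (≡.subst (Z ∘ inj₁) (≡.sym (⊕-assoc s 2 (t * 2))) Zs)))

    odd-arcs⇒zero : (∀ i → ∃[ k ] k ≢ i) → Fin m → (∀ i j d → ConsecutiveHosts host i j d → Odd d) →
      ∀ j → (∀ w → w ≢ j → E w) → Z j
    odd-arcs⇒zero other k₀ odd (inj₁ u) equations with previousHost k₀ u
    ... | i , p , u≡ , nonHost with nextHost i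
    ...   | d , j , c = ≡.subst (Z ∘ inj₁) (≡.sym u≡) (by-parity (p % 2 ℕ.≟ 1))
      where
      p<d : p < d
      p<d = ℕ.≰⇒> λ d≤p → nonHost d (positive c) d≤p j (reached c)
      hosts : ∀ k → Z (inj₁ (to k))
      hosts k = host-zero (equations (inj₂ k) λ ())
      interior : ∀ e → 0 < e → e < d → e ≢ p → Interior (to i ⊕ e)
      interior e 0<e e<d e≢p = first c e 0<e e<d , equations _ λ eq →
        e≢p (⊕-injective (to i) e p (ℕ.<-≤-trans e<d (length≤ c)) (ℕ.<-≤-trans p<d (length≤ c)) (≡.trans (inj₁-injective eq) u≡))
      by-parity : Dec (Odd p) → Z (inj₁ (to i ⊕ p))
      by-parity (no ¬odd) with even-form p ¬odd
      ... | t , ≡.refl = forward (to i) t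
        (λ e 0<e e<p → interior e 0<e (ℕ.<-trans e<p p<d) (ℕ.<⇒≢ e<p)) (hosts i)
      by-parity (yes p-odd) with odd-form p p-odd | odd-form d (odd i j d c)
      ... | a , p≡ | b , d≡ = backward (to i ⊕ p) (b ∸ a)
        (λ e 0<e e<q → ≡.subst Interior (≡.sym (⊕-assoc (to i) p e))
          (interior (p + e) (ℕ.<-≤-trans 0<e (ℕ.m≤n+m e p))
            (≡.subst (p + e <_) p+q≡d (ℕ.+-monoʳ-< p e<q))
            (ℕ.>⇒≢ (ℕ.m<m+n p 0<e))))
        (≡.subst (Z ∘ inj₁) (≡.trans (reached c) (≡.trans (≡.cong (to i ⊕_) (≡.sym p+q≡d)) (≡.sym (⊕-assoc (to i) p _)))) (hosts j))
        where
        p+q≡d : p + (b ∸ a) * 2 ≡ d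
        p+q≡d = begin
          p + (b ∸ a) * 2                        ≡⟨ ≡.cong (p +_) (ℕ.*-distribʳ-∸ 2 b a) ⟩
          p + (suc (b * 2) ∸ suc (a * 2))        ≡⟨ ≡.cong₂ (λ x y → p + (x ∸ y)) d≡ p≡ ⟨
          p + (d ∸ p)                            ≡⟨ ℕ.m+[n∸m]≡n (ℕ.<⇒≤ p<d) ⟩
          d                                      ∎
          where open ≡.≡-Reasoning
    odd-arcs⇒zero other k₀ odd (inj₂ k) equations =
      -- For a pendant vertex `k` its own equation is excluded, so no zero at its host is available.
      -- Both cycle neighbours of that host get zeros from the far ends of the adjacent arcs, which
      -- belong to other hosts, and the equation at the host does the rest.
      force ≡.refl neighbours (equations (inj₁ (to k)) λ ())
      where
      hosts : ∀ l → l ≢ k → Z (inj₁ (to l))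
      hosts l l≢k = host-zero (equations (inj₂ l) (l≢k ∘ inj₂-injective))
      interior : ∀ {v} → NonHost v → Interior v
      interior nonHost = nonHost , equations _ λ ()
      neighbours : ∀ v → inj₁ (to k) ~ v → v ≢ inj₂ k → Z v
      neighbours (inj₂ l) eq v≢k = contradiction (≡.cong inj₂ (≡.sym (injective eq))) v≢k
      neighbours (inj₁ _) (inj₁ ≡.refl) _ with nextHost k
      ... | d , j , c with odd-form d (odd k j d c)
      ...   | t , d≡ = backward (to k ⊕ 1) t
        (λ e 0<e e<d → ≡.subst Interior (≡.sym (⊕-assoc (to k) 1 e))
          (interior (first c (suc e) z<s (≡.subst (suc e <_) (≡.sym d≡) (s<s e<d)))))
        (≡.subst (Z ∘ inj₁) (≡.trans (reached c) (≡.trans (≡.cong (to k ⊕_) d≡) (≡.sym (⊕-assoc (to k) 1 _))))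
          (hosts j (distinct-ends (other k) c ∘ ≡.sym)))
      -- The arc ending at host `k` has odd length `suc p`, so `v` lies at even offset `p` from its
      -- start.
      neighbours (inj₁ v) (inj₂ k≡v⊕1) _ with previousHost k v
      ... | i , p , v≡ , nonHost = by-form (odd-form (suc p) (odd i k (suc p) c))
        where
        c : ConsecutiveHosts host i k (suc p)
        c = record
          { positive = z<s
          ; reached  = ≡.trans k≡v⊕1 (≡.trans (≡.cong (_⊕ 1) v≡) (≡.trans (⊕-assoc (to i) p 1) (≡.cong (to i ⊕_) (ℕ.+-comm p 1))))
          ; first    = λ e 0<e e<p → nonHost e 0<e (ℕ.<⇒≤pred e<p)
          }
        by-form : ∃[ t ] suc p ≡ suc (t * 2) → Z (inj₁ v)
        by-form (t , ≡.refl) = ≡.subst (Z ∘ inj₁) (≡.sym v≡) (forward (to i) t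
          (λ e 0<e e<p → interior (nonHost e 0<e (ℕ.<⇒≤ e<p)))
          (hosts i (distinct-ends (other i) c)))

    even-arc⇒equation : (∀ {w} → (∀ v → w ~ v → Z v) → E w) →
      ∀ {i j d} → ConsecutiveHosts host i j d → ¬ Odd d →
      (∀ w → w ≢ inj₁ (to i ⊕ 1) → E w) → E (inj₁ (to i ⊕ 1))
    even-arc⇒equation fill {i} {j} {d} c ¬odd equations with even-form d ¬odd
    ... | zero  , ≡.refl = contradiction (positive c) λ ()
    ... | suc t , ≡.refl = fill neighbours
      where
      hosts : ∀ k → Z (inj₁ (to k))
      hosts k = host-zero (equations (inj₂ k) λ ())
      interior : ∀ e → 0 < e → e < t * 2 → Interior (to i ⊕ 2 ⊕ e)
      interior e 0<e e<t = ≡.subst Interior (≡.sym (⊕-assoc (to i) 2 e))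
        (first c (2 + e) z<s 2+e<d , equations _ λ eq → contradiction
          (⊕-injective (to i) (2 + e) 1 (ℕ.<-≤-trans 2+e<d (length≤ c)) (ℕ.<-≤-trans (s<s z<s) (length≤ c)) (inj₁-injective eq))
          λ ())
        where
        2+e<d : 2 + e < 2 + t * 2
        2+e<d = s<s (s<s e<t)
      Z₂ : Z (inj₁ (to i ⊕ 2))
      -- What remains of the arc has even length `t * 2`, so the zero at the far host is carried
      -- back; for `t` zero this vertex is that host.
      Z₂ = backward (to i ⊕ 2) t interior
        (≡.subst (Z ∘ inj₁) (≡.trans (reached c) (≡.sym (⊕-assoc (to i) 2 (t * 2)))) (hosts j))
      neighbours : ∀ v → inj₁ (to i ⊕ 1) ~ v → Z v
      neighbours (inj₁ v) (inj₁ v≡) = ≡.subst (Z ∘ inj₁) (≡.sym (≡.trans v≡ (⊕-assoc (to i) 1 1))) Z₂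
      neighbours (inj₁ v) (inj₂ eq) = ≡.subst (Z ∘ inj₁) (⊕1-injective eq) (hosts i)
      neighbours (inj₂ k) eq        = contradiction (≡.sym eq) (first c 1 z<s (s<s z<s) k)

-- From sign patterns to zero propagation, and the two implications

module SignPatterns {c ℓ₁ ℓ₂} (ℝ : RealField c ℓ₁ ℓ₂) where
  open RealField ℝ using (_<ʳ_; isStrictTotalOrder; compare; commutativeRing; +-monoˡ-<)
  open IsStrictTotalOrder isStrictTotalOrder using (irrefl; asym)
  open CommutativeRing commutativeRing hiding (zero; _+_) renaming (_*_ to _*ʳ_)
  open RingProperties ring using (-0#≈0#; -‿involutive)
  open PVertices ℝ
  open Determinant commutativeRing

  sgn-zero : ∀ {x} → x ≈ 0# → sgn ℝ x ≡ nul
  sgn-zero {x} x≈0 with compare 0# x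
  ... | tri< 0<x _ _ = contradiction x≈0 (pos⇒≉0 0<x)
  ... | tri≈ _ _ _   = ≡.refl
  ... | tri> _ _ x<0 = contradiction x<0 (irrefl x≈0)

  sgn≡nul⇒zero : ∀ {x} → sgn ℝ x ≡ nul → x ≈ 0#
  sgn≡nul⇒zero {x} eq with compare 0# x
  ... | tri< _ _ _   = contradiction eq λ ()
  ... | tri≈ _ 0≈x _ = sym 0≈x
  ... | tri> _ _ _   = contradiction eq λ ()

  sgn-pos : ∀ {x} → 0# <ʳ x → sgn ℝ x ≡ pos
  sgn-pos {x} 0<x with compare 0# x
  ... | tri< _ _ _   = ≡.refl
  ... | tri≈ _ 0≈x _ = contradiction (sym 0≈x) (pos⇒≉0 0<x)
  ... | tri> _ _ x<0 = contradiction x<0 (asym 0<x)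

  sgn-neg : ∀ {x} → x <ʳ 0# → sgn ℝ x ≡ neg
  sgn-neg {x} x<0 with compare 0# x
  ... | tri< 0<x _ _ = contradiction x<0 (asym 0<x)
  ... | tri≈ _ 0≈x _ = contradiction x<0 (irrefl (sym 0≈x))
  ... | tri> _ _ _   = ≡.refl

  value : Sgn → Carrier
  value pos = 1#
  value neg = - 1#
  value nul = 0#

  sgn-value : ∀ s → sgn ℝ (value s) ≡ s
  sgn-value pos = sgn-pos 1-pos
  sgn-value neg = sgn-neg (<-respˡ (+-identityˡ _) (<-respʳ (-‿inverseʳ 1#) (+-monoˡ-< (- 1#) 1-pos)))
  sgn-value nul = sgn-zero refl

  nul? : ∀ s → Dec (s ≡ nul)
  nul? pos = no λ ()
  nul? neg = no λ ()
  nul? nul = yes ≡.refl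

  module _ {N n m} {P : SignPattern (suc N)} (P-sym : SymmetricPattern P)
           (host : Fin (suc (suc m)) ↣ Fin (suc n)) (iso : G[ P ] ≅ (C suc n ·P₁ host)) where
    open Inverse (proj₁ iso) using (to; from; strictlyInverseˡ; strictlyInverseʳ)
    open Arcs host

    private
      V = Fin (suc n) ⊎ Fin (suc (suc m))

      _~_ : V → V → Set
      _~_ = C suc n ·P₁ host

    module Vanishing (A : Matrix Carrier (suc N)) (A∈Q : Q-SYM ℝ P A) (x : Vector Carrier (suc N)) where
      B : Matrix Carrier (suc N)
      B i j = - A i j

      Z E : V → Set ℓ₁
      Z v = x (from v) ≈ 0#
      E w = B (from w) · x ≈ 0#

      -- Adjacency is decided through the sign entry: a `nul` entry kills the coefficient, any other
      -- entry is an edge and the neighbour carries a zero.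
      term-zero : ∀ w j → (w ~ to j → Z (to j)) → B (from w) j *ʳ x j ≈ 0#
      term-zero w j neighbour with nul? (P (from w) j)
      ... | yes P≡nul = trans (*-congʳ (trans (-‿cong (sgn≡nul⇒zero (≡.trans (proj₂ A∈Q (from w) j) P≡nul))) -0#≈0#)) (zeroˡ _)
      ... | no  P≢nul = trans (*-congˡ (trans (reflexive (≡.cong x (≡.sym (strictlyInverseʳ j)))) (neighbour
                          (≡.subst (_~ to j) (strictlyInverseˡ w) (Equivalence.to (proj₂ iso (from w) j) P≢nul))))) (zeroʳ _)

      edge-nonzero : ∀ {w v} → w ~ v → ¬ (B (from w) (from v) ≈ 0#)
      edge-nonzero {w} {v} w~v B≈0 = Equivalence.from (proj₂ iso (from w) (from v))
        (≡.subst₂ _~_ (≡.sym (strictlyInverseˡ w)) (≡.sym (strictlyInverseˡ v)) w~v)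
        (≡.trans (≡.sym (proj₂ A∈Q (from w) (from v)))
          (sgn-zero (trans (sym (-‿involutive _)) (trans (-‿cong B≈0) -0#≈0#))))

      fill : ∀ {w} → (∀ v → w ~ v → Z v) → E w
      fill {w} neighbours = ∑-zero λ j → term-zero w j (neighbours (to j))

      -- Zeros at all other neighbours reduce equation `w` to one term, whose coefficient is nonzero
      -- because it sits on an edge.
      force : ∀ {w v₀} → w ~ v₀ → (∀ v → w ~ v → v ≢ v₀ → Z v) → E w → Z v₀
      force {w} {v₀} w~v₀ others Ew = *-cancel-0 (edge-nonzero w~v₀)
        (trans (sym (∑-single _ (from v₀) λ j j≢ → term-zero w j λ w~j →
          others (to j) w~j λ to-j≡v₀ → j≢ (≡.trans (≡.sym (strictlyInverseʳ j)) (≡.cong from to-j≡v₀)))) Ew)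

      open Propagation Z E force public

    oddArcs⇒fullPVertices : (∀ i j d → ConsecutiveHosts host i j d → Odd d) → RequiresFullPVertices ℝ P
    oddArcs⇒fullPVertices odd A A∈Q = pVertex A (proj₁ A∈Q) diagonal-zero
      where
      other : ∀ (i : Fin (suc (suc m))) → ∃[ k ] k ≢ i
      other zero    = suc zero , λ ()
      other (suc i) = zero , λ ()
      diagonal-zero : InverseDiagonalZero (λ i j → - A i j)
      diagonal-zero j x Bx≈0 = trans (reflexive (≡.cong x (≡.sym (strictlyInverseʳ j))))
        (odd-arcs⇒zero other zero odd (to j) λ w w≢ →
          Bx≈0 (from w) λ from-w≡j → w≢ (≡.trans (≡.sym (strictlyInverseˡ w)) (≡.cong to from-w≡j)))
        where open Vanishing A A∈Q x

    fullPVertices⇒oddArcs : RequiresFullPVertices ℝ P → ∀ i j d → ConsecutiveHosts host i j d → Odd d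
    fullPVertices⇒oddArcs full i j d arc with d % 2 ℕ.≟ 1
    ... | yes odd = odd
    ... | no ¬odd = contradiction (trans (sym (expand-row B (from v))) Ev) (allPVertices⇒det≉0 A (full A A∈Q))
      where
      A : Matrix Carrier (suc N)
      -- Every matrix of the class is singular when some arc is even, so any representative serves.
      A i j = value (P i j)
      A∈Q : Q-SYM ℝ P A
      A∈Q = (λ i j → reflexive (≡.cong value (P-sym i j))) , λ i j → sgn-value (P i j)
      v : V
      v = inj₁ (Injection.to host i ⊕ 1)
      -- This column of the adjugate satisfies all equations except possibly the one at `v`, whose
      -- left side is the determinant; deriving that equation as well makes the determinant zero.
      open Vanishing A A∈Q (cofactor (λ i j → - A i j) (from v))
      Ev : E v
      Ev = even-arc⇒equation fill arc ¬odd λ w w≢v → expand-alien B λ from-w≡ →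
        w≢v (≡.trans (≡.sym (strictlyInverseˡ w)) (≡.trans (≡.cong to from-w≡) (strictlyInverseˡ v)))

theorem3p6 : ∀ {c ℓ₁ ℓ₂} (ℝ : RealField c ℓ₁ ℓ₂) (n m : ℕ) →
    3 ≤ n → 1 < m → m ≤ n →
    (P : SignPattern (n + m)) → SymmetricPattern P → ZeroDiagonal P →
    (host : Fin m ↣ Fin n) → G[ P ] ≅ (C n ·P₁ host) →
    RequiresFullPVertices ℝ P ⇔
    (∀ i j d → ConsecutiveHosts host i j d → Odd d)
theorem3p6 ℝ _ _ (s≤s _) (s≤s (s≤s _)) _ P P-sym _ host iso =
  mk⇔ (fullPVertices⇒oddArcs P-sym host iso) (oddArcs⇒fullPVertices P-sym host iso)
  where open SignPatterns ℝ
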